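{- For all integers $n \geq 1$ and $k\ge 1$ and all real $x$, $$c_{n}^{(k)}(x) = \delta_{n,1} + (-1)^{n} n \sum_{m=1}^n \frac{1}{m} \genfrac{[}{]}{0pt}{}{n-1}{m-1}\sum_{j=1}^m \binom{m}{j} B_{m-j} \, \mathbb{C}_j^{(k)}(x+1)$$ and $$\widehat{c}_{n}^{(k)}(x) = \delta_{n,1} + (-1)^{n} n \sum_{m=1}^n \frac{1}{m} \genfrac{[}{]}{0pt}{}{n-1}{m-1}\sum_{j=1}^m (-1)^j \binom{m}{j} B_{m-j} \, \mathbb{C}_j^{(k)}(x-1),$$ where $\mathbb{C}_j^{(k)}(x)$ is the polynomial in $x$ of degree $j$ defined by $\mathbb{C}_0^{(k)}(x)=1$ and $$\mathbb{C}_j^{(k)}(x) = \sum_{i=0}^{j} \frac{(-1)^i}{(i+1)^k} \binom{j}{i} x^{j-i}, \qquad j \geq 1.$$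
   Context: For real $z$ and integer $n\ge 0$, $\binom{z}{n} = \frac{z(z-1)\cdots(z-n+1)}{n!}$. For integers $n\ge0$, $k\ge1$, the poly-Cauchy polynomials of the first and second kind are $$c_n^{(k)}(x) = n! \int_{0}^{1}\!\! \cdots \int_{0}^{1} \binom{t_1 \cdots t_k - x}{n}\,dt_1 \cdots dt_k,\qquad \widehat{c}_n^{(k)}(x) = n! \int_{0}^{1}\!\! \cdots \int_{0}^{1} \binom{x - t_1 \cdots t_k}{n}\,dt_1 \cdots dt_k.$$ $\genfrac{[}{]}{0pt}{}{n}{m}$ are the unsigned Stirling numbers of the first kind. $B_m$ are the Bernoulli numbers, $\frac{t}{e^t-1}=\sum_{m\ge0} B_m \frac{t^m}{m!}$ (so $B_1=-\tfrac12$). $\delta_{n,1}$ is the Kronecker delta. -}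

module Defs where

open import Algebra.Bundles using (RawRing)
import Algebra.Definitions.RawSemiring as RawSemiringDefs
open import Data.Fin.Base using (Fin; zero; suc; toℕ)
open import Data.Integer.Base using (+_)
open import Data.Nat.Base as ℕ using (ℕ; zero; suc; _∸_; _!)
open import Data.Nat.Combinatorics using (_C_)
import Data.Nat.Properties as ℕₚ
open import Data.Product using (Σ; ∃; _×_; _,_)
open import Data.Rational.Base as ℚ using (ℚ; 0ℚ; 1ℚ; ½; Positive)
import Data.Rational.Properties as ℚₚ
open import Data.Rational.Solver using (module +-*-Solver)
open import Data.Sum.Base using (inj₁; inj₂)
open import Data.Unit.Base using (⊤)
open import Data.Vec.Base as Vec using (Vec; []; _∷_; _∷ʳ_)
open import Level using (0ℓ)
open import Relation.Binary.PropositionalEquality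
open import Relation.Nullary.Decidable using (does)
open import Data.Bool.Base using (if_then_else_)

private
  module Q where
    open import Data.Rational.Base using (_+_; _-_; _*_; -_; 1/_; _<_; _≤_; ∣_∣)
    open +-*-Solver using (solve; _:=_; _:+_; _:-_; _:*_; :-_)
    open ℚₚ.≤-Reasoning

    ½ε+½ε≡ε : ∀ ε → ½ * ε + ½ * ε ≡ ε
    ½ε+½ε≡ε ε = trans (sym (ℚₚ.*-distribʳ-+ ε ½ ½)) (ℚₚ.*-identityˡ ε)

    0<½ε : ∀ {ε} → 0ℚ < ε → 0ℚ < ½ * ε
    0<½ε {ε} 0<ε = ℚₚ.positive⁻¹ (½ * ε)
      where instance
        _ = ℚ.positive 0<ε
        _ = ℚₚ.pos*pos⇒pos ½ ε

    ∣p∣-∣q∣≤∣p-q∣ : ∀ p q → ∣ p ∣ - ∣ q ∣ ≤ ∣ p - q ∣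
    ∣p∣-∣q∣≤∣p-q∣ p q = begin
      ∣ p ∣ - ∣ q ∣                 ≡⟨ cong (λ r → ∣ r ∣ - ∣ q ∣) (solve 2 (λ a b → a := (a :- b) :+ b) refl p q) ⟩
      ∣ (p - q) + q ∣ - ∣ q ∣       ≤⟨ ℚₚ.+-monoˡ-≤ (- ∣ q ∣) (ℚₚ.∣p+q∣≤∣p∣+∣q∣ (p - q) q) ⟩
      (∣ p - q ∣ + ∣ q ∣) - ∣ q ∣   ≡⟨ solve 2 (λ a b → (a :+ b) :- b := a) refl ∣ p - q ∣ ∣ q ∣ ⟩
      ∣ p - q ∣                     ∎

    ∣p-q∣≡∣q-p∣ : ∀ p q → ∣ p - q ∣ ≡ ∣ q - p ∣
    ∣p-q∣≡∣q-p∣ p q = trans (sym (ℚₚ.∣-p∣≡∣p∣ (p - q)))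
      (cong ∣_∣ (solve 2 (λ a b → :- (a :- b) := b :- a) refl p q))

    ∣∣p∣-∣q∣∣≤∣p-q∣ : ∀ p q → ∣ ∣ p ∣ - ∣ q ∣ ∣ ≤ ∣ p - q ∣
    ∣∣p∣-∣q∣∣≤∣p-q∣ p q with ℚₚ.∣p∣≡p∨∣p∣≡-p (∣ p ∣ - ∣ q ∣)
    ... | inj₁ eq = subst (_≤ ∣ p - q ∣) (sym eq) (∣p∣-∣q∣≤∣p-q∣ p q)
    ... | inj₂ eq = begin
      ∣ ∣ p ∣ - ∣ q ∣ ∣   ≡⟨ eq ⟩
      - (∣ p ∣ - ∣ q ∣)   ≡⟨ solve 2 (λ a b → :- (a :- b) := b :- a) refl ∣ p ∣ ∣ q ∣ ⟩
      ∣ q ∣ - ∣ p ∣       ≤⟨ ∣p∣-∣q∣≤∣p-q∣ q p ⟩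
      ∣ q - p ∣           ≡⟨ ∣p-q∣≡∣q-p∣ q p ⟩
      ∣ p - q ∣           ∎

    +-diff : ∀ p q r s → ∣ (p + q) - (r + s) ∣ ≤ ∣ p - r ∣ + ∣ q - s ∣
    +-diff p q r s = begin
      ∣ (p + q) - (r + s) ∣   ≡⟨ cong ∣_∣ (solve 4 (λ a b c d → (a :+ b) :- (c :+ d) := (a :- c) :+ (b :- d)) refl p q r s) ⟩
      ∣ (p - r) + (q - s) ∣   ≤⟨ ℚₚ.∣p+q∣≤∣p∣+∣q∣ (p - r) (q - s) ⟩
      ∣ p - r ∣ + ∣ q - s ∣   ∎

    *-diff : ∀ p q r s → ∣ p * q - r * s ∣ ≤ ∣ p ∣ * ∣ q - s ∣ + ∣ s ∣ * ∣ p - r ∣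
    *-diff p q r s = begin
      ∣ p * q - r * s ∣                       ≡⟨ cong ∣_∣ (solve 4 (λ a b c d → a :* b :- c :* d := a :* (b :- d) :+ d :* (a :- c)) refl p q r s) ⟩
      ∣ p * (q - s) + s * (p - r) ∣           ≤⟨ ℚₚ.∣p+q∣≤∣p∣+∣q∣ (p * (q - s)) (s * (p - r)) ⟩
      ∣ p * (q - s) ∣ + ∣ s * (p - r) ∣       ≡⟨ cong₂ _+_ (ℚₚ.∣p*q∣≡∣p∣*∣q∣ p (q - s)) (ℚₚ.∣p*q∣≡∣p∣*∣q∣ s (p - r)) ⟩
      ∣ p ∣ * ∣ q - s ∣ + ∣ s ∣ * ∣ p - r ∣   ∎

    *-mono-bound : ∀ {a b M δ} → .{{_ : Positive M}} → 0ℚ ≤ b → a ≤ M → b < δ → a * b < M * δ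
    *-mono-bound {a} {b} {M} {δ} 0≤b a≤M b<δ = begin-strict
      a * b   ≤⟨ ℚₚ.*-monoʳ-≤-nonNeg b {{ℚ.nonNegative 0≤b}} a≤M ⟩
      M * b   <⟨ ℚₚ.*-monoʳ-<-pos M b<δ ⟩
      M * δ   ∎

    p≤p+q : ∀ {p q} → 0ℚ ≤ q → p ≤ p + q
    p≤p+q {p} {q} 0≤q = subst (_≤ p + q) (ℚₚ.+-identityʳ p) (ℚₚ.+-monoʳ-≤ p 0≤q)

    scale : ∀ M .{{_ : Positive M}} {ε} → 0ℚ < ε → ∃ λ δ → 0ℚ < δ × M * δ ≡ ½ * ε
    scale M {ε} 0<ε = 1/ M * (½ * ε) , ℚₚ.positive⁻¹ _ ,
      trans (sym (ℚₚ.*-assoc M (1/ M) (½ * ε)))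
        (trans (cong (_* (½ * ε)) (ℚₚ.*-inverseʳ M)) (ℚₚ.*-identityˡ (½ * ε)))
      where instance
        _ = ℚₚ.pos⇒nonZero M
        _ = ℚₚ.1/pos⇒pos M
        _ = ℚ.positive (0<½ε 0<ε)
        _ = ℚₚ.pos*pos⇒pos (1/ M) (½ * ε)

    *-close : ∀ {p q r s M δ ε} → .{{_ : Positive M}} → M * δ ≡ ½ * ε →
      ∣ p ∣ ≤ M → ∣ s ∣ ≤ M → ∣ q - s ∣ < δ → ∣ p - r ∣ < δ → ∣ p * q - r * s ∣ < ε
    *-close {p} {q} {r} {s} {M} {δ} {ε} Mδ≡½ε p≤M s≤M q-s p-r = begin-strict
      ∣ p * q - r * s ∣                       ≤⟨ *-diff p q r s ⟩
      ∣ p ∣ * ∣ q - s ∣ + ∣ s ∣ * ∣ p - r ∣   <⟨ ℚₚ.+-mono-< (*-mono-bound (ℚₚ.0≤∣p∣ (q - s)) p≤M q-s)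
                                                             (*-mono-bound (ℚₚ.0≤∣p∣ (p - r)) s≤M p-r) ⟩
      M * δ + M * δ                           ≡⟨ cong₂ _+_ Mδ≡½ε Mδ≡½ε ⟩
      ½ * ε + ½ * ε                           ≡⟨ ½ε+½ε≡ε ε ⟩
      ε                                       ∎

    upperBound : ∀ {A B} → 0ℚ ≤ A → 0ℚ ≤ B → ∃ λ M → Positive M × A ≤ M × B ≤ M
    upperBound {A} {B} 0≤A 0≤B = 1ℚ + (A + B)
      , ℚ.positive (ℚₚ.<-≤-trans (ℚₚ.positive⁻¹ 1ℚ) (p≤p+q (ℚₚ.≤-trans 0≤A (p≤p+q 0≤B))))
      , ℚₚ.≤-trans (p≤p+q 0≤B) A+B≤M
      , ℚₚ.≤-trans (subst (B ≤_) (ℚₚ.+-comm B A) (p≤p+q 0≤A)) A+B≤M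
      where
      A+B≤M : A + B ≤ 1ℚ + (A + B)
      A+B≤M = subst (A + B ≤_) (ℚₚ.+-comm (A + B) 1ℚ) (p≤p+q (ℚₚ.nonNegative⁻¹ 1ℚ))

Cauchy : (ℕ → ℚ) → Set
Cauchy s = ∀ ε → 0ℚ ℚ.< ε → ∃ λ N → ∀ m n → N ℕ.≤ m → N ℕ.≤ n → ℚ.∣ s m ℚ.- s n ∣ ℚ.< ε

-- Equality of reals is _≈_ (the difference of the sequences tends to 0), not _≡_.
record ℝ : Set where
  constructor mkℝ
  field
    seq    : ℕ → ℚ
    cauchy : Cauchy seq

open ℝ public

infix 4 _≈_ _≤_

record _≈_ (x y : ℝ) : Set where
  constructor mk≈
  field
    close : ∀ ε → 0ℚ ℚ.< ε → ∃ λ N → ∀ n → N ℕ.≤ n → ℚ.∣ seq x n ℚ.- seq y n ∣ ℚ.< ε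

record _≤_ (x y : ℝ) : Set where
  constructor mk≤
  field
    below : ∀ ε → 0ℚ ℚ.< ε → ∃ λ N → ∀ n → N ℕ.≤ n → seq x n ℚ.< seq y n ℚ.+ ε

fromℚ : ℚ → ℝ
fromℚ q = mkℝ (λ _ → q) λ ε 0<ε → 0 , λ _ _ _ _ →
  subst (λ r → ℚ.∣ r ∣ ℚ.< ε) (sym (ℚₚ.+-inverseʳ q)) 0<ε

0ℝ 1ℝ : ℝ
0ℝ = fromℚ 0ℚ
1ℝ = fromℚ 1ℚ

infixl 6 _+_ _-_
infixl 7 _*_
infix  8 -_

_+_ : ℝ → ℝ → ℝ
mkℝ s cs + mkℝ t ct = mkℝ (λ n → s n ℚ.+ t n) λ ε 0<ε →
  let N₁ , h₁ = cs (½ ℚ.* ε) (Q.0<½ε 0<ε)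
      N₂ , h₂ = ct (½ ℚ.* ε) (Q.0<½ε 0<ε)
  in N₁ ℕ.⊔ N₂ , λ m n N≤m N≤n → ℚₚ.≤-<-trans
       (Q.+-diff (s m) (t m) (s n) (t n))
       (subst (_ ℚ.<_) (Q.½ε+½ε≡ε ε) (ℚₚ.+-mono-<
         (h₁ m n (ℕₚ.m⊔n≤o⇒m≤o N₁ N₂ N≤m) (ℕₚ.m⊔n≤o⇒m≤o N₁ N₂ N≤n))
         (h₂ m n (ℕₚ.m⊔n≤o⇒n≤o N₁ N₂ N≤m) (ℕₚ.m⊔n≤o⇒n≤o N₁ N₂ N≤n))))

-_ : ℝ → ℝ
- mkℝ s cs = mkℝ (λ n → ℚ.- s n) λ ε 0<ε →
  let N , h = cs ε 0<ε
  in N , λ m n N≤m N≤n → subst (ℚ._< ε)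
       (trans (sym (ℚₚ.∣-p∣≡∣p∣ (s m ℚ.- s n)))
              (cong ℚ.∣_∣ (ℚₚ.neg-distrib-+ (s m) (ℚ.- s n))))
       (h m n N≤m N≤n)

_-_ : ℝ → ℝ → ℝ
x - y = x + (- y)

∣_∣ : ℝ → ℝ
∣ mkℝ s cs ∣ = mkℝ (λ n → ℚ.∣ s n ∣) λ ε 0<ε →
  let N , h = cs ε 0<ε
  in N , λ m n N≤m N≤n → ℚₚ.≤-<-trans (Q.∣∣p∣-∣q∣∣≤∣p-q∣ (s m) (s n)) (h m n N≤m N≤n)

eventuallyBounded : ∀ s → Cauchy s →
  ∃ λ N → ∃ λ M → 0ℚ ℚ.≤ M × (∀ n → N ℕ.≤ n → ℚ.∣ s n ∣ ℚ.≤ M)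
eventuallyBounded s cs =
  let N , h = cs 1ℚ (ℚₚ.positive⁻¹ 1ℚ)
      open ℚₚ.≤-Reasoning
      open +-*-Solver
  in N , 1ℚ ℚ.+ ℚ.∣ s N ∣
   , ℚₚ.≤-trans (ℚₚ.nonNegative⁻¹ 1ℚ) (Q.p≤p+q (ℚₚ.0≤∣p∣ (s N)))
   , λ n N≤n → begin
       ℚ.∣ s n ∣                             ≡⟨ cong ℚ.∣_∣ (solve 2 (λ a b → a := (a :- b) :+ b) refl (s n) (s N)) ⟩
       ℚ.∣ (s n ℚ.- s N) ℚ.+ s N ∣           ≤⟨ ℚₚ.∣p+q∣≤∣p∣+∣q∣ (s n ℚ.- s N) (s N) ⟩
       ℚ.∣ s n ℚ.- s N ∣ ℚ.+ ℚ.∣ s N ∣       ≤⟨ ℚₚ.+-monoˡ-≤ ℚ.∣ s N ∣ (ℚₚ.<⇒≤ (h n N N≤n ℕₚ.≤-refl)) ⟩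
       1ℚ ℚ.+ ℚ.∣ s N ∣                      ∎

*-cauchy : ∀ s t → Cauchy s → Cauchy t → Cauchy (λ n → s n ℚ.* t n)
*-cauchy s t cs ct ε 0<ε =
  let N₁ , A , 0≤A , s≤A       = eventuallyBounded s cs
      N₂ , B , 0≤B , t≤B       = eventuallyBounded t ct
      M , M-pos , A≤M , B≤M    = Q.upperBound 0≤A 0≤B
      δ , 0<δ , Mδ≡½ε          = Q.scale M {{M-pos}} 0<ε
      N₃ , hs                  = cs δ 0<δ
      N₄ , ht                  = ct δ 0<δ
  in (N₁ ℕ.⊔ N₂) ℕ.⊔ (N₃ ℕ.⊔ N₄) , λ m n N≤m N≤n →
       Q.*-close {s m} {t m} {s n} {t n} {{M-pos}} Mδ≡½ε
         (ℚₚ.≤-trans (s≤A m (ℕₚ.m⊔n≤o⇒m≤o N₁ N₂ (ℕₚ.m⊔n≤o⇒m≤o (N₁ ℕ.⊔ N₂) _ N≤m))) A≤M)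
         (ℚₚ.≤-trans (t≤B n (ℕₚ.m⊔n≤o⇒n≤o N₁ N₂ (ℕₚ.m⊔n≤o⇒m≤o (N₁ ℕ.⊔ N₂) _ N≤n))) B≤M)
         (ht m n (ℕₚ.m⊔n≤o⇒n≤o N₃ N₄ (ℕₚ.m⊔n≤o⇒n≤o (N₁ ℕ.⊔ N₂) _ N≤m))
                 (ℕₚ.m⊔n≤o⇒n≤o N₃ N₄ (ℕₚ.m⊔n≤o⇒n≤o (N₁ ℕ.⊔ N₂) _ N≤n)))
         (hs m n (ℕₚ.m⊔n≤o⇒m≤o N₃ N₄ (ℕₚ.m⊔n≤o⇒n≤o (N₁ ℕ.⊔ N₂) _ N≤m))
                 (ℕₚ.m⊔n≤o⇒m≤o N₃ N₄ (ℕₚ.m⊔n≤o⇒n≤o (N₁ ℕ.⊔ N₂) _ N≤n)))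

_*_ : ℝ → ℝ → ℝ
x * y = mkℝ (λ n → seq x n ℚ.* seq y n) (*-cauchy (seq x) (seq y) (cauchy x) (cauchy y))

ℝ-rawRing : RawRing 0ℓ 0ℓ
ℝ-rawRing = record
  { Carrier = ℝ ; _≈_ = _≈_ ; _+_ = _+_ ; _*_ = _*_ ; -_ = -_ ; 0# = 0ℝ ; 1# = 1ℝ }

open RawSemiringDefs (RawRing.rawSemiring ℝ-rawRing) public using (_^_; sum; product)

module ℚΣ = RawSemiringDefs ℚ.+-*-rawSemiring

fromℕ : ℕ → ℚ
fromℕ n = + n ℚ./ 1

1/_! : ℕ → ℚ
1/ n ! = (+ 1 ℚ./ (n !)) {{n ℕₚ.!≢0}}

data TaggedPartition : ℝ → ℝ → Set where
  done : ∀ {a b} → a ≈ b → TaggedPartition a b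
  step : ∀ {a b} (tag next : ℝ) → a ≤ tag → tag ≤ next →
         TaggedPartition next b → TaggedPartition a b

MeshAtMost : ∀ {a b} → ℚ → TaggedPartition a b → Set
MeshAtMost δ (done _)                = ⊤
MeshAtMost δ (step {a} _ next _ _ P) = (next - a ≤ fromℚ δ) × MeshAtMost δ P

riemannSum : ∀ {a b} → (ℝ → ℝ) → TaggedPartition a b → ℝ
riemannSum f (done _)                  = 0ℝ
riemannSum f (step {a} tag next _ _ P) = f tag * (next - a) + riemannSum f P

-- f is Riemann integrable on [a , b] and its integral is I.
HasIntegral : (f : ℝ → ℝ) (a b I : ℝ) → Set
HasIntegral f a b I =
  ∀ ε → 0ℚ ℚ.< ε → ∃ λ δ → 0ℚ ℚ.< δ ×
    (∀ (P : TaggedPartition a b) → MeshAtMost δ P → ∣ riemannSum f P - I ∣ ≤ fromℚ ε)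

-- ∫₀¹ ⋯ ∫₀¹ f (t₁ , … , tₖ) dt₁ ⋯ dtₖ exists as an iterated integral, with
-- tₖ the variable of the outermost one, and its value is I.
HasIteratedIntegral : ∀ k → (Vec ℝ k → ℝ) → ℝ → Set
HasIteratedIntegral zero    f I = f [] ≈ I
HasIteratedIntegral (suc k) f I =
  ∃ λ (g : ℝ → ℝ) →
    (∀ t → 0ℝ ≤ t → t ≤ 1ℝ → HasIteratedIntegral k (λ ts → f (ts ∷ʳ t)) (g t)) ×
    HasIntegral g 0ℝ 1ℝ I

binom : ℝ → ℕ → ℝ
binom z n = fromℚ (1/ n !) * product {n} (λ i → z - fromℚ (fromℕ (toℕ i)))

Π : ∀ {k} → Vec ℝ k → ℝ
Π = Vec.foldr _ _*_ 1ℝ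

-- Values of c_n^{(k)}(x) and ĉ_n^{(k)}(x): since integrals are given by a
-- relation, so are these; v is the value at x.
IsPolyCauchy₁ IsPolyCauchy₂ : (n k : ℕ) (x v : ℝ) → Set
IsPolyCauchy₁ n k x v =
  ∃ λ I → HasIteratedIntegral k (λ ts → binom (Π ts - x) n) I × v ≈ fromℚ (fromℕ (n !)) * I
IsPolyCauchy₂ n k x v =
  ∃ λ I → HasIteratedIntegral k (λ ts → binom (x - Π ts) n) I × v ≈ fromℚ (fromℕ (n !)) * I

-- The unsigned Stirling number [n over m] of the first kind.
stirling₁ : ℕ → ℕ → ℕ
stirling₁ zero    zero    = 1
stirling₁ zero    (suc m) = 0
stirling₁ (suc n) zero    = 0
stirling₁ (suc n) (suc m) = n ℕ.* stirling₁ n (suc m) ℕ.+ stirling₁ n m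

-- f stands for the formal series Σₙ f n · tⁿ.
PowerSeries : Set
PowerSeries = ℕ → ℚ

infixl 7 _⊛_

_⊛_ : PowerSeries → PowerSeries → PowerSeries
(f ⊛ g) n = ℚΣ.sum {suc n} (λ i → f (toℕ i) ℚ.* g (n ∸ toℕ i))

𝟙 𝕥 : PowerSeries
𝟙 zero    = 1ℚ
𝟙 (suc _) = 0ℚ
𝕥 zero    = 0ℚ
𝕥 (suc n) = 𝟙 n

expMinusOne : PowerSeries
expMinusOne zero    = 0ℚ
expMinusOne (suc n) = 1/ suc n !

-- Coefficients n , n−1 , … , 0 of 1/f, for f with constant term 1.
reciprocals : PowerSeries → ∀ n → Vec ℚ (suc n)
reciprocals f zero    = 1ℚ ∷ []
reciprocals f (suc n) =
  ℚ.- ℚΣ.sum (λ i → f (suc (toℕ i)) ℚ.* Vec.lookup (reciprocals f n) i) ∷ reciprocals f n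

reciprocal : PowerSeries → PowerSeries
reciprocal f n = Vec.head (reciprocals f n)

-- B_n = n! [tⁿ] 1/((eᵗ − 1)/t)
bernoulli : ℕ → ℚ
bernoulli n = fromℕ (n !) ℚ.* reciprocal (λ m → expMinusOne (suc m)) n

private
  sum-cong : ∀ {n} {f g : Fin n → ℚ} → (∀ i → f i ≡ g i) → ℚΣ.sum f ≡ ℚΣ.sum g
  sum-cong {zero}  h = refl
  sum-cong {suc n} h = cong₂ ℚ._+_ (h zero) (sum-cong (λ i → h (suc i)))

  lookup-reciprocals : ∀ f n i → Vec.lookup (reciprocals f n) i ≡ reciprocal f (n ∸ toℕ i)
  lookup-reciprocals f zero    zero    = refl
  lookup-reciprocals f (suc n) zero    = refl
  lookup-reciprocals f (suc n) (suc i) = lookup-reciprocals f n i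

  n!*1/n! : ∀ n → fromℕ (n !) ℚ.* 1/ n ! ≡ 1ℚ
  n!*1/n! n = lemma (n !) {{n ℕₚ.!≢0}}
    where
    open import Data.Integer.Base using (ℤ)
    import Data.Integer.Properties as ℤₚ
    import Data.Rational.Unnormalised.Base as ℚᵘ
    import Data.Rational.Unnormalised.Properties as ℚᵘₚ
    lemma : ∀ m .{{_ : ℕ.NonZero m}} → fromℕ m ℚ.* (+ 1 ℚ./ m) ≡ 1ℚ
    lemma m@(suc m-1) = ℚₚ.toℚᵘ-injective (ℚᵘₚ.≃-trans
      (ℚₚ.toℚᵘ-homo-* (fromℕ m) (+ 1 ℚ./ m))
      (ℚᵘₚ.≃-trans
        (ℚᵘₚ.*-cong (ℚₚ.toℚᵘ-fromℚᵘ (ℚᵘ.mkℚᵘ (+ m) 0)) (ℚₚ.toℚᵘ-fromℚᵘ (ℚᵘ.mkℚᵘ (+ 1) m-1)))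
        (ℚᵘ.*≡* (trans (ℤₚ.*-identityʳ _) (trans (ℤₚ.*-identityʳ (+ m))
          (sym (trans (ℤₚ.*-identityˡ _) (ℤₚ.*-identityˡ (+ m)))))))))

⊛-reciprocal : ∀ f → f 0 ≡ 1ℚ → ∀ n → (f ⊛ reciprocal f) n ≡ 𝟙 n
⊛-reciprocal f f₀≡1 zero    = cong (λ q → q ℚ.* 1ℚ ℚ.+ 0ℚ) f₀≡1
⊛-reciprocal f f₀≡1 (suc n) = begin
  f 0 ℚ.* (ℚ.- S) ℚ.+ S′   ≡⟨ cong₂ (λ q r → q ℚ.* (ℚ.- S) ℚ.+ r) f₀≡1
                                (sum-cong {suc n} (λ i → cong (f (suc (toℕ i)) ℚ.*_) (sym (lookup-reciprocals f n i)))) ⟩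
  1ℚ ℚ.* (ℚ.- S) ℚ.+ S     ≡⟨ cong (ℚ._+ S) (ℚₚ.*-identityˡ (ℚ.- S)) ⟩
  ℚ.- S ℚ.+ S              ≡⟨ ℚₚ.+-inverseˡ S ⟩
  0ℚ                       ∎
  where
  open ≡-Reasoning
  S  = ℚΣ.sum (λ i → f (suc (toℕ i)) ℚ.* Vec.lookup (reciprocals f n) i)
  S′ = ℚΣ.sum {suc n} (λ i → f (suc (toℕ i)) ℚ.* reciprocal f (n ∸ toℕ i))

-- (eᵗ − 1) · Σₘ Bₘ tᵐ/m! = t
bernoulli-generatingFunction : ∀ n → (expMinusOne ⊛ (λ m → bernoulli m ℚ.* 1/ m !)) n ≡ 𝕥 n
bernoulli-generatingFunction zero    = refl
bernoulli-generatingFunction (suc n) = begin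
  0ℚ ℚ.* b (suc n) ℚ.+ (f ⊛ b) n   ≡⟨ cong (ℚ._+ (f ⊛ b) n) (ℚₚ.*-zeroˡ (b (suc n))) ⟩
  0ℚ ℚ.+ (f ⊛ b) n                 ≡⟨ ℚₚ.+-identityˡ _ ⟩
  (f ⊛ b) n                        ≡⟨ sum-cong {suc n} (λ i → cong (f (toℕ i) ℚ.*_) (b≡ (n ∸ toℕ i))) ⟩
  (f ⊛ reciprocal f) n             ≡⟨ ⊛-reciprocal f refl n ⟩
  𝟙 n                              ∎
  where
  open ≡-Reasoning
  f b : PowerSeries
  f m = expMinusOne (suc m)
  b m = bernoulli m ℚ.* 1/ m !
  b≡ : ∀ m → b m ≡ reciprocal f m
  b≡ m = trans (cong (ℚ._* 1/ m !) (ℚₚ.*-comm (fromℕ (m !)) (reciprocal f m)))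
    (trans (ℚₚ.*-assoc (reciprocal f m) (fromℕ (m !)) (1/ m !))
      (trans (cong (reciprocal f m ℚ.*_) (n!*1/n! m)) (ℚₚ.*-identityʳ (reciprocal f m))))

δ : ℕ → ℕ → ℚ
δ m n = if does (m ℕₚ.≟ n) then 1ℚ else 0ℚ

[-1]^_ : ℕ → ℚ
[-1]^ n = (ℚ.- 1ℚ) ℚΣ.^ n

ℂ : (j k : ℕ) → ℝ → ℝ
ℂ zero      k x = 1ℝ
ℂ j@(suc _) k x = sum {suc j} λ i →
  fromℚ ([-1]^ toℕ i ℚ.* (+ 1 ℚ./ suc (toℕ i)) ℚΣ.^ k ℚ.* fromℕ (j C toℕ i)) * x ^ (j ∸ toℕ i)

sumFrom1 : (n : ℕ) → ((i : ℕ) → .{{ℕ.NonZero i}} → ℝ) → ℝ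
sumFrom1 n f = sum {n} (λ i → f (suc (toℕ i)))

infixr 5 sumFrom1
syntax sumFrom1 n (λ i → e) = ∑[1≤ i ≤ n ] e

{-# OPTIONS --safe #-}

-- With y = 1 − z, both integrands reduce to one polynomial identity over ℚ,
--   z (z − 1) ⋯ (z − n + 1) = δ_{n,1} + (−1)ⁿ n Σₘ 1/m [n−1, m−1] (B_m(y) − B_m):
-- its sides agree at y = 0, and by B_m(y + 1) − B_m(y) = m yᵐ⁻¹ they have the same
-- difference in y. Here y = w − t₁⋯tₖ with w = x + 1 for the first kind and
-- −y = w − t₁⋯tₖ with w = x − 1 for the second. Since ∫₀¹ tⁱ dt = 1/(i + 1), the binomial
-- theorem gives ℂ_j(w) as the integral of (w − t₁⋯tₖ)ʲ, and the expansion of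
-- B_m(y) − B_m in powers of y is integrated term by term.
module Submission where

open import Defs
open import Algebra.Bundles using (CommutativeRing)
import Algebra.Properties.CommutativeMonoid.Sum as MonoidSum
import Algebra.Properties.CommutativeSemiring.Binomial as Binomial
import Algebra.Properties.CommutativeSemiring.Exp as Exp
import Algebra.Properties.Semiring.Mult as Mult
import Algebra.Properties.Semiring.Sum as SemiringSum
open import Data.Fin.Base using (Fin; zero; suc; toℕ)
import Data.Fin.Properties as Finₚ
open import Data.Integer.Base as ℤ using (+_)
import Data.Integer.Properties as ℤₚ
open import Data.Nat.Base as ℕ using (ℕ; zero; suc; _∸_; _!; s≤s; z≤n)
open import Data.Nat.Combinatorics using (_C_; nCk≡n!/k![n-k]!; k![n∸k]!∣n!)
open import Data.Nat.DivMod using (m/n*n≡m)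
import Data.Nat.Properties as ℕₚ
open import Data.Product using (∃; _×_; _,_; proj₁; proj₂)
open import Data.Rational.Base as ℚ using (ℚ; 0ℚ; 1ℚ; ½)
import Data.Rational.Properties as ℚₚ
open import Data.Rational.Solver using (module +-*-Solver)
import Data.Rational.Unnormalised.Base as ℚᵘ
import Data.Rational.Unnormalised.Properties as ℚᵘₚ
open import Data.Sum.Base using (inj₁; inj₂)
open import Data.Vec.Base using (Vec; []; _∷_; _∷ʳ_)
open import Function.Base using (_∘_)
open import Relation.Binary.PropositionalEquality
open +-*-Solver using (solve; _:=_; _:+_; _:-_; _:*_; :-_; con)

-- Reals are Cauchy sequences with termwise operations, and nothing in `HasIntegral` makes an
-- integrand respect `≈`. Hence every algebraic step is an identity over ℚ applied at each index of
-- the sequences. Inequalities cannot be read off index by index: `a ≤ tag` constrains only the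
-- limits. `NonNeg` states such a fact about limits and is closed under sums and under products of
-- bounded sequences, so an estimate is proved by a ring identity that writes its slack as a sum of
-- products of nonnegative quantities.
--
-- In the polynomial identity, δ_{n,1} is the value at y = 0: there z = 1, and the product contains
-- the factor 1 - 1 as soon as n > 1. The difference in y of the left side is (-1)ⁿ n y (y + 1) ⋯ (y
-- + n - 2), a rising factorial whose coefficients are the numbers [n-1, m-1]. On the right the
-- factor 1/m cancels the m of m yᵐ⁻¹.
--
-- The only integrals estimated by Riemann sums are those of the monomials tⁱ and of 0. For
-- monomials, monotonicity and convexity give an explicit error proportional to the mesh; the other
-- integrals follow by linearity and by separating the variables of (t₁⋯tₖ)ⁱ.

private
  module ℚRing = CommutativeRing ℚₚ.+-*-commutativeRing
  module ℚMult = Mult ℚRing.semiring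

sum-cong-≗ : ∀ {n} {f g : Fin n → ℚ} → f ≗ g → ℚΣ.sum f ≡ ℚΣ.sum g
sum-cong-≗ = MonoidSum.sum-cong-≗ ℚRing.+-commutativeMonoid

sum-distrib-+ : ∀ {n} (f g : Fin n → ℚ) → ℚΣ.sum (λ i → f i ℚ.+ g i) ≡ ℚΣ.sum f ℚ.+ ℚΣ.sum g
sum-distrib-+ = MonoidSum.∑-distrib-+ ℚRing.+-commutativeMonoid

*-distribˡ-sum : ∀ {n} q (f : Fin n → ℚ) → q ℚ.* ℚΣ.sum f ≡ ℚΣ.sum (λ i → q ℚ.* f i)
*-distribˡ-sum = SemiringSum.*-distribˡ-sum ℚRing.semiring

*-distribʳ-sum : ∀ {n} q (f : Fin n → ℚ) → ℚΣ.sum f ℚ.* q ≡ ℚΣ.sum (λ i → f i ℚ.* q)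
*-distribʳ-sum = SemiringSum.*-distribʳ-sum ℚRing.semiring

-- Rational constants

fromℕ-+ : ∀ m n → fromℕ (m ℕ.+ n) ≡ fromℕ m ℚ.+ fromℕ n
fromℕ-+ m n = ℚₚ.toℚᵘ-injective (ℚᵘₚ.≃-trans
  (ℚₚ.toℚᵘ-fromℚᵘ (ℚᵘ.mkℚᵘ (+ (m ℕ.+ n)) 0))
  (ℚᵘₚ.≃-trans
    (ℚᵘ.*≡* (cong (ℤ._* + 1) (sym (cong₂ ℤ._+_ (ℤₚ.*-identityʳ (+ m)) (ℤₚ.*-identityʳ (+ n))))))
    (ℚᵘₚ.≃-trans
      (ℚᵘₚ.≃-sym (ℚᵘₚ.+-cong (ℚₚ.toℚᵘ-fromℚᵘ (ℚᵘ.mkℚᵘ (+ m) 0)) (ℚₚ.toℚᵘ-fromℚᵘ (ℚᵘ.mkℚᵘ (+ n) 0))))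
      (ℚᵘₚ.≃-sym (ℚₚ.toℚᵘ-homo-+ (fromℕ m) (fromℕ n))))))

fromℕ-suc : ∀ n → fromℕ (suc n) ≡ 1ℚ ℚ.+ fromℕ n
fromℕ-suc = fromℕ-+ 1

fromℕ-* : ∀ m n → fromℕ (m ℕ.* n) ≡ fromℕ m ℚ.* fromℕ n
fromℕ-* zero    n = sym (ℚₚ.*-zeroˡ (fromℕ n))
fromℕ-* (suc m) n = begin
  fromℕ (n ℕ.+ m ℕ.* n)                  ≡⟨ fromℕ-+ n (m ℕ.* n) ⟩
  fromℕ n ℚ.+ fromℕ (m ℕ.* n)            ≡⟨ cong (fromℕ n ℚ.+_) (fromℕ-* m n) ⟩
  fromℕ n ℚ.+ fromℕ m ℚ.* fromℕ n        ≡⟨ solve 2 (λ a b → a :+ b :* a := (con 1ℚ :+ b) :* a) refl (fromℕ n) (fromℕ m) ⟩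
  (1ℚ ℚ.+ fromℕ m) ℚ.* fromℕ n           ≡⟨ cong (ℚ._* fromℕ n) (sym (fromℕ-suc m)) ⟩
  fromℕ (suc m) ℚ.* fromℕ n              ∎
  where open ≡-Reasoning

fromℕ-inverse : ∀ m .{{_ : ℕ.NonZero m}} → fromℕ m ℚ.* (+ 1 ℚ./ m) ≡ 1ℚ
fromℕ-inverse m@(suc m-1) = ℚₚ.toℚᵘ-injective (ℚᵘₚ.≃-trans
  (ℚₚ.toℚᵘ-homo-* (fromℕ m) (+ 1 ℚ./ m))
  (ℚᵘₚ.≃-trans
    (ℚᵘₚ.*-cong (ℚₚ.toℚᵘ-fromℚᵘ (ℚᵘ.mkℚᵘ (+ m) 0)) (ℚₚ.toℚᵘ-fromℚᵘ (ℚᵘ.mkℚᵘ (+ 1) m-1)))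
    (ℚᵘₚ.*-inverseʳ (ℚᵘ.mkℚᵘ (+ m) 0))))

n!*1/n! : ∀ n → fromℕ (n !) ℚ.* 1/ n ! ≡ 1ℚ
n!*1/n! n = fromℕ-inverse (n !) {{n ℕₚ.!≢0}}

-- Turns binomial sums into Cauchy products of coefficients divided by factorials, as needed in
-- `exp-+` and `bernoulliSum-exp`.
fromℕ[nCk]*1/n! : ∀ {n k} → k ℕ.≤ n → fromℕ (n C k) ℚ.* 1/ n ! ≡ 1/ k ! ℚ.* 1/ (n ∸ k) !
fromℕ[nCk]*1/n! {n} {k} k≤n = begin
  c ℚ.* w                                     ≡⟨ solve 2 (λ c w → c :* w := c :* w :* (con 1ℚ :* con 1ℚ)) refl c w ⟩
  c ℚ.* w ℚ.* (1ℚ ℚ.* 1ℚ)                     ≡⟨ cong₂ (λ p q → c ℚ.* w ℚ.* (p ℚ.* q)) (sym (n!*1/n! k)) (sym (n!*1/n! (n ∸ k))) ⟩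
  c ℚ.* w ℚ.* ((a ℚ.* u) ℚ.* (b ℚ.* v))       ≡⟨ solve 6 (λ a b c u v w → c :* w :* ((a :* u) :* (b :* v)) := (c :* (a :* b)) :* w :* (u :* v)) refl a b c u v w ⟩
  (c ℚ.* (a ℚ.* b)) ℚ.* w ℚ.* (u ℚ.* v)       ≡⟨ cong (λ p → p ℚ.* w ℚ.* (u ℚ.* v)) (sym n!≡) ⟩
  fromℕ (n !) ℚ.* w ℚ.* (u ℚ.* v)             ≡⟨ cong (ℚ._* (u ℚ.* v)) (n!*1/n! n) ⟩
  1ℚ ℚ.* (u ℚ.* v)                            ≡⟨ ℚₚ.*-identityˡ (u ℚ.* v) ⟩
  u ℚ.* v                                     ∎
  where
  open ≡-Reasoning
  a = fromℕ (k !)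
  b = fromℕ ((n ∸ k) !)
  c = fromℕ (n C k)
  u = 1/ k !
  v = 1/ (n ∸ k) !
  w = 1/ n !
  instance
    _ = k ℕₚ.!* (n ∸ k) !≢0
  n!≡ : fromℕ (n !) ≡ c ℚ.* (a ℚ.* b)
  n!≡ = begin
    fromℕ (n !)                                 ≡⟨ cong fromℕ (sym (trans (cong (ℕ._* (k ! ℕ.* (n ∸ k) !)) (nCk≡n!/k![n-k]! k≤n))
                                                                          (m/n*n≡m (k![n∸k]!∣n! k≤n)))) ⟩
    fromℕ ((n C k) ℕ.* (k ! ℕ.* (n ∸ k) !))     ≡⟨ fromℕ-* (n C k) _ ⟩
    c ℚ.* fromℕ (k ! ℕ.* (n ∸ k) !)             ≡⟨ cong (c ℚ.*_) (fromℕ-* (k !) _) ⟩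
    c ℚ.* (a ℚ.* b)                             ∎

×≡fromℕ* : ∀ n q → n ℚMult.× q ≡ fromℕ n ℚ.* q
×≡fromℕ* zero    q = sym (ℚₚ.*-zeroˡ q)
×≡fromℕ* (suc n) q = begin
  q ℚ.+ n ℚMult.× q              ≡⟨ cong (q ℚ.+_) (×≡fromℕ* n q) ⟩
  q ℚ.+ fromℕ n ℚ.* q            ≡⟨ solve 2 (λ q n → q :+ n :* q := (con 1ℚ :+ n) :* q) refl q (fromℕ n) ⟩
  (1ℚ ℚ.+ fromℕ n) ℚ.* q         ≡⟨ cong (ℚ._* q) (sym (fromℕ-suc n)) ⟩
  fromℕ (suc n) ℚ.* q            ∎
  where open ≡-Reasoning

binomialTheorem : ∀ n x y →
  (x ℚ.+ y) ℚΣ.^ n ≡ ℚΣ.sum {suc n} (λ i → fromℕ (n C toℕ i) ℚ.* (x ℚΣ.^ toℕ i ℚ.* y ℚΣ.^ (n ∸ toℕ i)))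
binomialTheorem n x y = trans (Binomial.theorem ℚRing.commutativeSemiring n x y)
  (sum-cong-≗ (λ (i : Fin (suc n)) → ×≡fromℕ* (n C toℕ i) (x ℚΣ.^ toℕ i ℚ.* y ℚΣ.^ (n ∸ toℕ i))))

-- Power series

infixl 6 _⊞_
_⊞_ : PowerSeries → PowerSeries → PowerSeries
(f ⊞ g) n = f n ℚ.+ g n

⊛-cong : ∀ {f f′ g g′ : PowerSeries} → f ≗ f′ → g ≗ g′ → f ⊛ g ≗ f′ ⊛ g′
⊛-cong p q n = sum-cong-≗ (λ (i : Fin (suc n)) → cong₂ ℚ._*_ (p (toℕ i)) (q (n ∸ toℕ i)))

⊛-distribʳ-⊞ : ∀ (h f g : PowerSeries) → (f ⊞ g) ⊛ h ≗ (f ⊛ h) ⊞ (g ⊛ h)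
⊛-distribʳ-⊞ h f g n = trans
  (sum-cong-≗ (λ (i : Fin (suc n)) → ℚₚ.*-distribʳ-+ (h (n ∸ toℕ i)) (f (toℕ i)) (g (toℕ i))))
  (sum-distrib-+ {suc n} (λ i → f (toℕ i) ℚ.* h (n ∸ toℕ i)) (λ i → g (toℕ i) ℚ.* h (n ∸ toℕ i)))

⊛-distribˡ-⊞ : ∀ (h f g : PowerSeries) → h ⊛ (f ⊞ g) ≗ (h ⊛ f) ⊞ (h ⊛ g)
⊛-distribˡ-⊞ h f g n = trans
  (sum-cong-≗ (λ (i : Fin (suc n)) → ℚₚ.*-distribˡ-+ (h (toℕ i)) (f (n ∸ toℕ i)) (g (n ∸ toℕ i))))
  (sum-distrib-+ {suc n} (λ i → h (toℕ i) ℚ.* f (n ∸ toℕ i)) (λ i → h (toℕ i) ℚ.* g (n ∸ toℕ i)))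

⊛-scaleˡ : ∀ c (f g : PowerSeries) → (λ n → c ℚ.* f n) ⊛ g ≗ λ n → c ℚ.* (f ⊛ g) n
⊛-scaleˡ c f g n = trans
  (sum-cong-≗ (λ (i : Fin (suc n)) → ℚₚ.*-assoc c (f (toℕ i)) (g (n ∸ toℕ i))))
  (sym (*-distribˡ-sum {suc n} c (λ i → f (toℕ i) ℚ.* g (n ∸ toℕ i))))

-- Induction on the coefficient index. Without its constant term, `f ⊛ g` is by computation `f 0`
-- times `g⁺` plus `f⁺ ⊛ g`, so distributivity leads to the same law for `f⁺` at the smaller index.
⊛-assoc : ∀ (f g h : PowerSeries) → (f ⊛ g) ⊛ h ≗ f ⊛ (g ⊛ h)
⊛-assoc f g h zero    = solve 3 (λ a b c → (a :* b :+ con 0ℚ) :* c :+ con 0ℚ := a :* (b :* c :+ con 0ℚ) :+ con 0ℚ) refl (f 0) (g 0) (h 0)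
⊛-assoc f g h (suc n) = begin
  (f 0 ℚ.* g 0 ℚ.+ 0ℚ) ℚ.* h (suc n) ℚ.+ (((λ i → f 0 ℚ.* g⁺ i) ⊞ (f⁺ ⊛ g)) ⊛ h) n
    ≡⟨ cong ((f 0 ℚ.* g 0 ℚ.+ 0ℚ) ℚ.* h (suc n) ℚ.+_) tails ⟩
  (f 0 ℚ.* g 0 ℚ.+ 0ℚ) ℚ.* h (suc n) ℚ.+ (f 0 ℚ.* (g⁺ ⊛ h) n ℚ.+ (f⁺ ⊛ (g ⊛ h)) n)
    ≡⟨ solve 5 (λ a b c d e → (a :* b :+ con 0ℚ) :* c :+ (a :* d :+ e) := a :* (b :* c :+ d) :+ e) refl
         (f 0) (g 0) (h (suc n)) ((g⁺ ⊛ h) n) ((f⁺ ⊛ (g ⊛ h)) n) ⟩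
  f 0 ℚ.* (g 0 ℚ.* h (suc n) ℚ.+ (g⁺ ⊛ h) n) ℚ.+ (f⁺ ⊛ (g ⊛ h)) n ∎
  where
  open ≡-Reasoning
  f⁺ g⁺ : PowerSeries
  f⁺ = f ∘ suc
  g⁺ = g ∘ suc
  tails : (((λ i → f 0 ℚ.* g⁺ i) ⊞ (f⁺ ⊛ g)) ⊛ h) n ≡ f 0 ℚ.* (g⁺ ⊛ h) n ℚ.+ (f⁺ ⊛ (g ⊛ h)) n
  tails = trans (⊛-distribʳ-⊞ h (λ i → f 0 ℚ.* g⁺ i) (f⁺ ⊛ g) n)
    (cong₂ ℚ._+_ (⊛-scaleˡ (f 0) g⁺ h n) (⊛-assoc f⁺ g h n))

⊛-identityˡ : ∀ f → 𝟙 ⊛ f ≗ f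
⊛-identityˡ f n = begin
  1ℚ ℚ.* f n ℚ.+ ℚΣ.sum {n} (λ i → 0ℚ ℚ.* f (n ∸ suc (toℕ i)))
    ≡⟨ cong₂ ℚ._+_ (ℚₚ.*-identityˡ (f n)) (sym (*-distribˡ-sum {n} 0ℚ (λ i → f (n ∸ suc (toℕ i))))) ⟩
  f n ℚ.+ 0ℚ ℚ.* ℚΣ.sum {n} (λ i → f (n ∸ suc (toℕ i)))
    ≡⟨ solve 2 (λ a b → a :+ con 0ℚ :* b := a) refl (f n) (ℚΣ.sum {n} (λ i → f (n ∸ suc (toℕ i)))) ⟩
  f n ∎
  where open ≡-Reasoning

⊛-𝕥 : ∀ f n → (f ⊛ 𝕥) (suc n) ≡ f n
⊛-𝕥 f zero    = solve 2 (λ a b → a :* con 1ℚ :+ (b :* con 0ℚ :+ con 0ℚ) := a) refl (f 0) (f 1)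
⊛-𝕥 f (suc n) = trans (cong (f 0 ℚ.* 0ℚ ℚ.+_) (⊛-𝕥 (f ∘ suc) n))
  (solve 2 (λ a b → a :* con 0ℚ :+ b := b) refl (f 0) (f (suc n)))

-- Coefficients of e^(yt) as a series in t.
exp : ℚ → PowerSeries
exp y n = y ℚΣ.^ n ℚ.* 1/ n !

^-zeroˡ : ∀ n → 1ℚ ℚΣ.^ n ≡ 1ℚ
^-zeroˡ zero    = refl
^-zeroˡ (suc n) = trans (ℚₚ.*-identityˡ (1ℚ ℚΣ.^ n)) (^-zeroˡ n)

^-distrib-* : ∀ x y n → (x ℚ.* y) ℚΣ.^ n ≡ x ℚΣ.^ n ℚ.* y ℚΣ.^ n
^-distrib-* = Exp.^-distrib-* ℚRing.commutativeSemiring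

neg-^ : ∀ p n → (ℚ.- p) ℚΣ.^ n ≡ [-1]^ n ℚ.* p ℚΣ.^ n
neg-^ p n = trans (cong (ℚΣ._^ n) (solve 1 (λ p → :- p := :- con 1ℚ :* p) refl p)) (^-distrib-* (ℚ.- 1ℚ) p n)

exp-+ : ∀ x y → exp (x ℚ.+ y) ≗ exp x ⊛ exp y
exp-+ x y n = begin
  (x ℚ.+ y) ℚΣ.^ n ℚ.* 1/ n !
    ≡⟨ cong (ℚ._* 1/ n !) (binomialTheorem n x y) ⟩
  ℚΣ.sum (λ (i : Fin (suc n)) → fromℕ (n C toℕ i) ℚ.* (x ℚΣ.^ toℕ i ℚ.* y ℚΣ.^ (n ∸ toℕ i))) ℚ.* 1/ n !
    ≡⟨ *-distribʳ-sum {suc n} (1/ n !) (λ i → fromℕ (n C toℕ i) ℚ.* (x ℚΣ.^ toℕ i ℚ.* y ℚΣ.^ (n ∸ toℕ i))) ⟩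
  ℚΣ.sum (λ (i : Fin (suc n)) → fromℕ (n C toℕ i) ℚ.* (x ℚΣ.^ toℕ i ℚ.* y ℚΣ.^ (n ∸ toℕ i)) ℚ.* 1/ n !)
    ≡⟨ sum-cong-≗ (λ (i : Fin (suc n)) → term (x ℚΣ.^ toℕ i) (y ℚΣ.^ (n ∸ toℕ i)) (toℕ i) (ℕ.s≤s⁻¹ (Finₚ.toℕ<n i))) ⟩
  (exp x ⊛ exp y) n ∎
  where
  open ≡-Reasoning
  term : ∀ p q k → k ℕ.≤ n → fromℕ (n C k) ℚ.* (p ℚ.* q) ℚ.* 1/ n ! ≡ p ℚ.* 1/ k ! ℚ.* (q ℚ.* 1/ (n ∸ k) !)
  term p q k k≤n = begin
    fromℕ (n C k) ℚ.* (p ℚ.* q) ℚ.* 1/ n !        ≡⟨ solve 4 (λ c p q w → c :* (p :* q) :* w := c :* w :* (p :* q)) refl (fromℕ (n C k)) p q (1/ n !) ⟩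
    fromℕ (n C k) ℚ.* 1/ n ! ℚ.* (p ℚ.* q)        ≡⟨ cong (ℚ._* (p ℚ.* q)) (fromℕ[nCk]*1/n! k≤n) ⟩
    1/ k ! ℚ.* 1/ (n ∸ k) ! ℚ.* (p ℚ.* q)         ≡⟨ solve 4 (λ u v p q → u :* v :* (p :* q) := p :* u :* (q :* v)) refl (1/ k !) (1/ (n ∸ k) !) p q ⟩
    p ℚ.* 1/ k ! ℚ.* (q ℚ.* 1/ (n ∸ k) !)         ∎

exp-1 : exp 1ℚ ≗ 𝟙 ⊞ expMinusOne
exp-1 zero    = refl
exp-1 (suc n) = begin
  1ℚ ℚΣ.^ suc n ℚ.* 1/ suc n !   ≡⟨ cong (ℚ._* 1/ suc n !) (^-zeroˡ (suc n)) ⟩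
  1ℚ ℚ.* 1/ suc n !              ≡⟨ ℚₚ.*-identityˡ (1/ suc n !) ⟩
  1/ suc n !                     ≡⟨ sym (ℚₚ.+-identityˡ (1/ suc n !)) ⟩
  0ℚ ℚ.+ 1/ suc n !              ∎
  where open ≡-Reasoning

-- Bernoulli polynomials

bernoulliSeries : PowerSeries
bernoulliSeries m = bernoulli m ℚ.* 1/ m !

-- With b = t/(eᵗ - 1), one has eᵗ b = b + (eᵗ - 1) b = b + t; multiply by e^(yt). As e^(yt) b
-- generates the Bernoulli polynomials, this is their difference equation in generating form.
exp⊛bernoulli-+1 : ∀ y → exp (y ℚ.+ 1ℚ) ⊛ bernoulliSeries ≗ (exp y ⊛ bernoulliSeries) ⊞ (exp y ⊛ 𝕥)
exp⊛bernoulli-+1 y n = begin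
  (exp (y ℚ.+ 1ℚ) ⊛ b) n             ≡⟨ ⊛-cong {g = b} (exp-+ y 1ℚ) (λ _ → refl) n ⟩
  ((exp y ⊛ exp 1ℚ) ⊛ b) n           ≡⟨ ⊛-assoc (exp y) (exp 1ℚ) b n ⟩
  (exp y ⊛ (exp 1ℚ ⊛ b)) n           ≡⟨ ⊛-cong {f = exp y} (λ _ → refl) e⊛b n ⟩
  (exp y ⊛ (b ⊞ 𝕥)) n                ≡⟨ ⊛-distribˡ-⊞ (exp y) b 𝕥 n ⟩
  ((exp y ⊛ b) ⊞ (exp y ⊛ 𝕥)) n      ∎
  where
  open ≡-Reasoning
  b = bernoulliSeries
  e⊛b : exp 1ℚ ⊛ b ≗ b ⊞ 𝕥
  e⊛b m = begin
    (exp 1ℚ ⊛ b) m                      ≡⟨ ⊛-cong {g = b} exp-1 (λ _ → refl) m ⟩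
    ((𝟙 ⊞ expMinusOne) ⊛ b) m           ≡⟨ ⊛-distribʳ-⊞ b 𝟙 expMinusOne m ⟩
    (𝟙 ⊛ b) m ℚ.+ (expMinusOne ⊛ b) m   ≡⟨ cong₂ ℚ._+_ (⊛-identityˡ b m) (bernoulli-generatingFunction m) ⟩
    b m ℚ.+ 𝕥 m                         ∎

-- B_m(y) − B_m
bernoulliSum : ℕ → ℚ → ℚ
bernoulliSum m y = ℚΣ.sum {m} (λ i → fromℕ (m C suc (toℕ i)) ℚ.* bernoulli (m ∸ suc (toℕ i)) ℚ.* y ℚΣ.^ suc (toℕ i))

-- B_m(y) is m! times the coefficient of tᵐ in e^(yt) t/(eᵗ - 1). Its term in y⁰ is B_m, and
-- subtracting it leaves exactly the range j ≥ 1.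
bernoulliSum-exp : ∀ m y → bernoulliSum m y ≡ fromℕ (m !) ℚ.* ((exp y ⊛ bernoulliSeries) m ℚ.- bernoulliSeries m)
bernoulliSum-exp m y = begin
  bernoulliSum m y
    ≡⟨ sum-cong-≗ (λ (i : Fin m) → term (y ℚΣ.^ suc (toℕ i)) (suc (toℕ i)) (Finₚ.toℕ<n i)) ⟩
  ℚΣ.sum {m} (λ i → fromℕ (m !) ℚ.* (exp y (suc (toℕ i)) ℚ.* bernoulliSeries (m ∸ suc (toℕ i))))
    ≡⟨ sym (*-distribˡ-sum {m} (fromℕ (m !)) (λ i → exp y (suc (toℕ i)) ℚ.* bernoulliSeries (m ∸ suc (toℕ i)))) ⟩
  fromℕ (m !) ℚ.* S
    -- `con 1ℚ :* b` is the term of index 0 of the convolution, since `exp y 0` computes to 1.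
    ≡⟨ cong (fromℕ (m !) ℚ.*_) (solve 2 (λ s b → s := con 1ℚ :* b :+ s :- b) refl S (bernoulliSeries m)) ⟩
  fromℕ (m !) ℚ.* ((exp y ⊛ bernoulliSeries) m ℚ.- bernoulliSeries m) ∎
  where
  open ≡-Reasoning
  S = ℚΣ.sum {m} (λ i → exp y (suc (toℕ i)) ℚ.* bernoulliSeries (m ∸ suc (toℕ i)))
  term : ∀ p k → k ℕ.≤ m → fromℕ (m C k) ℚ.* bernoulli (m ∸ k) ℚ.* p ≡ fromℕ (m !) ℚ.* (p ℚ.* 1/ k ! ℚ.* (bernoulli (m ∸ k) ℚ.* 1/ (m ∸ k) !))
  term p k k≤m = begin
    c ℚ.* B ℚ.* p                        ≡⟨ solve 3 (λ c B p → c :* B :* p := con 1ℚ :* (c :* B :* p)) refl c B p ⟩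
    1ℚ ℚ.* (c ℚ.* B ℚ.* p)               ≡⟨ cong (ℚ._* (c ℚ.* B ℚ.* p)) (sym (n!*1/n! m)) ⟩
    f ℚ.* w ℚ.* (c ℚ.* B ℚ.* p)          ≡⟨ solve 5 (λ f w c B p → f :* w :* (c :* B :* p) := f :* ((c :* w) :* (B :* p))) refl f w c B p ⟩
    f ℚ.* ((c ℚ.* w) ℚ.* (B ℚ.* p))      ≡⟨ cong (λ r → f ℚ.* (r ℚ.* (B ℚ.* p))) (fromℕ[nCk]*1/n! k≤m) ⟩
    f ℚ.* ((u ℚ.* v) ℚ.* (B ℚ.* p))      ≡⟨ solve 5 (λ f u v B p → f :* ((u :* v) :* (B :* p)) := f :* (p :* u :* (B :* v))) refl f u v B p ⟩
    f ℚ.* (p ℚ.* u ℚ.* (B ℚ.* v))        ∎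
    where
    c = fromℕ (m C k)
    B = bernoulli (m ∸ k)
    f = fromℕ (m !)
    w = 1/ m !
    u = 1/ k !
    v = 1/ (m ∸ k) !

bernoulliSum-+1 : ∀ m y → bernoulliSum (suc m) (y ℚ.+ 1ℚ) ≡ bernoulliSum (suc m) y ℚ.+ fromℕ (suc m) ℚ.* y ℚΣ.^ m
bernoulliSum-+1 m y = begin
  bernoulliSum (suc m) (y ℚ.+ 1ℚ)
    ≡⟨ bernoulliSum-exp (suc m) (y ℚ.+ 1ℚ) ⟩
  f ℚ.* ((exp (y ℚ.+ 1ℚ) ⊛ bernoulliSeries) (suc m) ℚ.- b)
    ≡⟨ cong (λ r → f ℚ.* (r ℚ.- b)) (trans (exp⊛bernoulli-+1 y (suc m)) (cong (e ℚ.+_) (⊛-𝕥 (exp y) m))) ⟩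
  f ℚ.* (e ℚ.+ p ℚ.* w ℚ.- b)
    ≡⟨ solve 5 (λ f e p w b → f :* (e :+ p :* w :- b) := f :* (e :- b) :+ f :* w :* p) refl f e p w b ⟩
  f ℚ.* (e ℚ.- b) ℚ.+ f ℚ.* w ℚ.* p
    ≡⟨ cong₂ (λ r s → r ℚ.+ s ℚ.* p) (sym (bernoulliSum-exp (suc m) y)) f*w ⟩
  bernoulliSum (suc m) y ℚ.+ fromℕ (suc m) ℚ.* p ∎
  where
  open ≡-Reasoning
  f = fromℕ (suc m !)
  w = 1/ m !
  b = bernoulliSeries (suc m)
  e = (exp y ⊛ bernoulliSeries) (suc m)
  p = y ℚΣ.^ m
  f*w : f ℚ.* w ≡ fromℕ (suc m)
  f*w = begin
    f ℚ.* w                                  ≡⟨ cong (ℚ._* w) (fromℕ-* (suc m) (m !)) ⟩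
    fromℕ (suc m) ℚ.* fromℕ (m !) ℚ.* w      ≡⟨ ℚₚ.*-assoc (fromℕ (suc m)) (fromℕ (m !)) w ⟩
    fromℕ (suc m) ℚ.* (fromℕ (m !) ℚ.* w)    ≡⟨ cong (fromℕ (suc m) ℚ.*_) (n!*1/n! m) ⟩
    fromℕ (suc m) ℚ.* 1ℚ                     ≡⟨ ℚₚ.*-identityʳ (fromℕ (suc m)) ⟩
    fromℕ (suc m)                            ∎

bernoulliSum-0 : ∀ m → bernoulliSum m 0ℚ ≡ 0ℚ
bernoulliSum-0 m = begin
  bernoulliSum m 0ℚ
    ≡⟨ sum-cong-≗ (λ (i : Fin m) → solve 2 (λ c p → c :* (con 0ℚ :* p) := c :* con 0ℚ) refl
         (fromℕ (m C suc (toℕ i)) ℚ.* bernoulli (m ∸ suc (toℕ i))) (0ℚ ℚΣ.^ toℕ i)) ⟩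
  ℚΣ.sum {m} (λ i → fromℕ (m C suc (toℕ i)) ℚ.* bernoulli (m ∸ suc (toℕ i)) ℚ.* 0ℚ)
    ≡⟨ sym (*-distribʳ-sum {m} 0ℚ (λ i → fromℕ (m C suc (toℕ i)) ℚ.* bernoulli (m ∸ suc (toℕ i)))) ⟩
  ℚΣ.sum {m} (λ i → fromℕ (m C suc (toℕ i)) ℚ.* bernoulli (m ∸ suc (toℕ i))) ℚ.* 0ℚ
    ≡⟨ ℚₚ.*-zeroʳ (ℚΣ.sum {m} (λ i → fromℕ (m C suc (toℕ i)) ℚ.* bernoulli (m ∸ suc (toℕ i)))) ⟩
  0ℚ ∎
  where open ≡-Reasoning

-- Falling factorials and Stirling numbers

fall : ℚ → ℕ → ℚ
fall z n = ℚΣ.product {n} (λ i → z ℚ.- fromℕ (toℕ i))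

product-cong : ∀ {n} {f g : Fin n → ℚ} → f ≗ g → ℚΣ.product f ≡ ℚΣ.product g
product-cong {zero}  h = refl
product-cong {suc n} h = cong₂ ℚ._*_ (h zero) (product-cong (h ∘ suc))

fall-sucˡ : ∀ z n → fall z (suc n) ≡ z ℚ.* fall (z ℚ.- 1ℚ) n
fall-sucˡ z n = cong₂ ℚ._*_ (solve 1 (λ z → z :- con 0ℚ := z) refl z)
  (product-cong {n} (λ i → trans (cong (λ r → z ℚ.- r) (fromℕ-suc (toℕ i)))
    (solve 2 (λ z i → z :- (con 1ℚ :+ i) := z :- con 1ℚ :- i) refl z (fromℕ (toℕ i)))))

-- `fall` unfolds at its first factor. The last factor is the one that matches the Stirling
-- recursion and that changes when y becomes y + 1.
fall-sucʳ : ∀ z n → fall z (suc n) ≡ fall z n ℚ.* (z ℚ.- fromℕ n)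
fall-sucʳ z zero    = solve 1 (λ z → (z :- con 0ℚ) :* con 1ℚ := con 1ℚ :* (z :- con 0ℚ)) refl z
fall-sucʳ z (suc n) = begin
  fall z (suc (suc n))                                              ≡⟨ fall-sucˡ z (suc n) ⟩
  z ℚ.* fall (z ℚ.- 1ℚ) (suc n)                                     ≡⟨ cong (z ℚ.*_) (fall-sucʳ (z ℚ.- 1ℚ) n) ⟩
  z ℚ.* (fall (z ℚ.- 1ℚ) n ℚ.* (z ℚ.- 1ℚ ℚ.- fromℕ n))              ≡⟨ solve 3 (λ z f n → z :* (f :* (z :- con 1ℚ :- n)) := z :* f :* (z :- (con 1ℚ :+ n))) refl z (fall (z ℚ.- 1ℚ) n) (fromℕ n) ⟩
  z ℚ.* fall (z ℚ.- 1ℚ) n ℚ.* (z ℚ.- (1ℚ ℚ.+ fromℕ n))              ≡⟨ cong₂ (λ p q → p ℚ.* (z ℚ.- q)) (sym (fall-sucˡ z n)) (sym (fromℕ-suc n)) ⟩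
  fall z (suc n) ℚ.* (z ℚ.- fromℕ (suc n))                          ∎
  where open ≡-Reasoning

[-1]^-square : ∀ n → [-1]^ n ℚ.* [-1]^ n ≡ 1ℚ
[-1]^-square zero    = refl
[-1]^-square (suc n) = trans
  (solve 1 (λ s → (:- con 1ℚ :* s) :* (:- con 1ℚ :* s) := s :* s) refl ([-1]^ n)) ([-1]^-square n)

sum-0 : ∀ n → ℚΣ.sum {n} (λ _ → 0ℚ) ≡ 0ℚ
sum-0 zero    = refl
sum-0 (suc n) = trans (ℚₚ.+-identityˡ (ℚΣ.sum {n} (λ _ → 0ℚ))) (sum-0 n)

-- The length L of the sum is free since stirling₁ n i vanishes for i > n.
stirling₁-fall : ∀ n L → n ℕ.< L → ∀ y →
  ℚΣ.sum {L} (λ i → fromℕ (stirling₁ n (toℕ i)) ℚ.* y ℚΣ.^ toℕ i) ≡ [-1]^ n ℚ.* fall (ℚ.- y) n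
stirling₁-fall zero    (suc L) _         y = begin
  1ℚ ℚ.* 1ℚ ℚ.+ ℚΣ.sum {L} (λ i → 0ℚ ℚ.* y ℚΣ.^ suc (toℕ i))
    ≡⟨ cong (1ℚ ℚ.* 1ℚ ℚ.+_) (trans (sum-cong-≗ (λ (i : Fin L) → ℚₚ.*-zeroˡ (y ℚΣ.^ suc (toℕ i)))) (sum-0 L)) ⟩
  1ℚ ∎
  where open ≡-Reasoning
stirling₁-fall (suc n) (suc L) (s≤s n<L) y = begin
  0ℚ ℚ.* 1ℚ ℚ.+ ℚΣ.sum {L} (λ i → fromℕ (n ℕ.* stirling₁ n (suc (toℕ i)) ℕ.+ stirling₁ n (toℕ i)) ℚ.* y ℚΣ.^ suc (toℕ i))
    ≡⟨ cong (0ℚ ℚ.* 1ℚ ℚ.+_) (trans (sum-cong-≗ (λ (i : Fin L) → term (toℕ i))) (sum-distrib-+ {L} _ _)) ⟩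
  0ℚ ℚ.* 1ℚ ℚ.+ (ℚΣ.sum {L} (λ i → fromℕ n ℚ.* (fromℕ (stirling₁ n (suc (toℕ i))) ℚ.* y ℚΣ.^ suc (toℕ i)))
    ℚ.+ ℚΣ.sum {L} (λ i → y ℚ.* (fromℕ (stirling₁ n (toℕ i)) ℚ.* y ℚΣ.^ toℕ i)))
    ≡⟨ cong (0ℚ ℚ.* 1ℚ ℚ.+_) (sym (cong₂ ℚ._+_
         (*-distribˡ-sum {L} (fromℕ n) (λ i → fromℕ (stirling₁ n (suc (toℕ i))) ℚ.* y ℚΣ.^ suc (toℕ i)))
         (*-distribˡ-sum {L} y (λ i → fromℕ (stirling₁ n (toℕ i)) ℚ.* y ℚΣ.^ toℕ i)))) ⟩
  0ℚ ℚ.* 1ℚ ℚ.+ (fromℕ n ℚ.* S⁺ ℚ.+ y ℚ.* S)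
    -- `S⁺` is the tail of a sum of length `suc L` and `S` has length `L`, so the induction
    -- hypothesis is used at both lengths. Completing the tail costs `n` times `s₀`, which vanishes:
    -- either n = 0 or [n, 0] = 0.
    ≡⟨ solve 5 (λ n S S⁺ y s → con 0ℚ :* con 1ℚ :+ (n :* S⁺ :+ y :* S) := n :* (s :* con 1ℚ :+ S⁺) :+ y :* S :- n :* s)
         refl (fromℕ n) S S⁺ y s₀ ⟩
  fromℕ n ℚ.* (s₀ ℚ.* 1ℚ ℚ.+ S⁺) ℚ.+ y ℚ.* S ℚ.- fromℕ n ℚ.* s₀
    ≡⟨ cong₂ ℚ._-_ (cong₂ (λ p q → fromℕ n ℚ.* p ℚ.+ y ℚ.* q)
         (stirling₁-fall n (suc L) (ℕₚ.m<n⇒m<1+n n<L) y) (stirling₁-fall n L n<L y)) (n*s₀≡0 n) ⟩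
  fromℕ n ℚ.* (σ ℚ.* F) ℚ.+ y ℚ.* (σ ℚ.* F) ℚ.- 0ℚ
    ≡⟨ solve 4 (λ n σ F y → n :* (σ :* F) :+ y :* (σ :* F) :- con 0ℚ := (:- con 1ℚ :* σ) :* (F :* (:- y :- n))) refl (fromℕ n) σ F y ⟩
  [-1]^ (suc n) ℚ.* (F ℚ.* (ℚ.- y ℚ.- fromℕ n))
    ≡⟨ cong ([-1]^ (suc n) ℚ.*_) (sym (fall-sucʳ (ℚ.- y) n)) ⟩
  [-1]^ (suc n) ℚ.* fall (ℚ.- y) (suc n) ∎
  where
  open ≡-Reasoning
  σ = [-1]^ n
  F = fall (ℚ.- y) n
  s₀ = fromℕ (stirling₁ n 0)
  S S⁺ : ℚ
  S  = ℚΣ.sum {L} (λ i → fromℕ (stirling₁ n (toℕ i)) ℚ.* y ℚΣ.^ toℕ i)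
  S⁺ = ℚΣ.sum {L} (λ i → fromℕ (stirling₁ n (suc (toℕ i))) ℚ.* y ℚΣ.^ suc (toℕ i))
  n*s₀≡0 : ∀ n → fromℕ n ℚ.* fromℕ (stirling₁ n 0) ≡ 0ℚ
  n*s₀≡0 zero    = refl
  n*s₀≡0 (suc n) = ℚₚ.*-zeroʳ (fromℕ (suc n))
  term : ∀ i → fromℕ (n ℕ.* stirling₁ n (suc i) ℕ.+ stirling₁ n i) ℚ.* y ℚΣ.^ suc i ≡
    fromℕ n ℚ.* (fromℕ (stirling₁ n (suc i)) ℚ.* y ℚΣ.^ suc i) ℚ.+ y ℚ.* (fromℕ (stirling₁ n i) ℚ.* y ℚΣ.^ i)
  term i = trans
    (cong (ℚ._* y ℚΣ.^ suc i) (trans (fromℕ-+ (n ℕ.* stirling₁ n (suc i)) (stirling₁ n i))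
      (cong (ℚ._+ fromℕ (stirling₁ n i)) (fromℕ-* n (stirling₁ n (suc i))))))
    (solve 5 (λ n a b y p → (n :* a :+ b) :* (y :* p) := n :* (a :* (y :* p)) :+ y :* (b :* p)) refl
      (fromℕ n) (fromℕ (stirling₁ n (suc i))) (fromℕ (stirling₁ n i)) y (y ℚΣ.^ i))

-- Polynomial functions of degree less than d, characterised by divisibility of f − f(a) by y − a.
Polynomial : ℕ → (ℚ → ℚ) → Set
Polynomial zero    f = ∀ y → f y ≡ 0ℚ
Polynomial (suc d) f = ∀ a → ∃ λ g → Polynomial d g × (∀ y → f y ≡ f a ℚ.+ (y ℚ.- a) ℚ.* g y)

polynomial-0 : ∀ d → Polynomial d (λ _ → 0ℚ)
polynomial-0 zero    = λ _ → refl
polynomial-0 (suc d) = λ a → (λ _ → 0ℚ) , polynomial-0 d ,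
  λ y → solve 2 (λ y a → con 0ℚ := con 0ℚ :+ (y :- a) :* con 0ℚ) refl y a

polynomial-const : ∀ c → Polynomial 1 (λ _ → c)
polynomial-const c a = (λ _ → 0ℚ) , polynomial-0 0 ,
  λ y → solve 3 (λ c y a → c := c :+ (y :- a) :* con 0ℚ) refl c y a

polynomial-id : Polynomial 2 (λ y → y)
polynomial-id a = (λ _ → 1ℚ) , polynomial-const 1ℚ ,
  λ y → solve 2 (λ y a → y := a :+ (y :- a) :* con 1ℚ) refl y a

polynomial-weaken : ∀ {d e f} → d ℕ.≤ e → Polynomial d f → Polynomial e f
polynomial-weaken {zero} {zero} z≤n p = p
polynomial-weaken {zero} {suc e} {f} z≤n p a = (λ _ → 0ℚ) , polynomial-0 e ,
  λ y → trans (p y) (trans (solve 2 (λ y a → con 0ℚ := con 0ℚ :+ (y :- a) :* con 0ℚ) refl y a)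
    (cong (ℚ._+ (y ℚ.- a) ℚ.* 0ℚ) (sym (p a))))
polynomial-weaken (s≤s d≤e) p a =
  let g , q , eq = p a in g , polynomial-weaken d≤e q , eq

polynomial-+ : ∀ {d f g} → Polynomial d f → Polynomial d g → Polynomial d (λ y → f y ℚ.+ g y)
polynomial-+ {zero}  p q y = cong₂ ℚ._+_ (p y) (q y)
polynomial-+ {suc d} {f} {g} p q a =
  let f′ , p′ , f≡ = p a
      g′ , q′ , g≡ = q a
  in (λ y → f′ y ℚ.+ g′ y) , polynomial-+ p′ q′ ,
     λ y → trans (cong₂ ℚ._+_ (f≡ y) (g≡ y))
       (solve 5 (λ u v d k l → (u :+ d :* k) :+ (v :+ d :* l) := (u :+ v) :+ d :* (k :+ l)) refl
         (f a) (g a) (y ℚ.- a) (f′ y) (g′ y))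

-- With f′ and g′ the difference quotients at a, f g - f(a) g(a) = (y - a)(f′ g + f(a) g′). The
-- bound d + e is not sharp; later only the existence of a bound matters.
polynomial-* : ∀ {d e f g} → Polynomial d f → Polynomial e g → Polynomial (d ℕ.+ e) (λ y → f y ℚ.* g y)
polynomial-* {zero} {e} {f} {g} p q = polynomial-weaken {zero} {e} z≤n
  (λ y → trans (cong (ℚ._* g y) (p y)) (ℚₚ.*-zeroˡ (g y)))
polynomial-* {suc d} {zero} {f} {g} p q = polynomial-weaken {zero} {suc d ℕ.+ 0} z≤n
  (λ y → trans (cong (f y ℚ.*_) (q y)) (ℚₚ.*-zeroʳ (f y)))
polynomial-* {suc d} {suc e} {f} {g} p q a =
  let f′ , p′ , f≡ = p a
      g′ , q′ , g≡ = q a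
  in (λ y → f′ y ℚ.* g y ℚ.+ f a ℚ.* g′ y)
   , polynomial-+ (polynomial-* p′ q)
       (polynomial-weaken {suc e} {d ℕ.+ suc e} (ℕₚ.m≤n+m (suc e) d) (polynomial-* {1} {e} {λ _ → f a} {g′} (polynomial-const (f a)) q′))
   , λ y → trans (cong (ℚ._* g y) (f≡ y)) (trans
       (solve 4 (λ u v d k → (u :+ d :* k) :* v := u :* v :+ d :* (k :* v)) refl (f a) (g y) (y ℚ.- a) (f′ y))
       (trans (cong (λ r → f a ℚ.* r ℚ.+ (y ℚ.- a) ℚ.* (f′ y ℚ.* g y)) (g≡ y))
         (solve 6 (λ u v d k l w → u :* (v :+ d :* l) :+ d :* (k :* w) := u :* v :+ d :* (k :* w :+ u :* l)) refl
           (f a) (g a) (y ℚ.- a) (f′ y) (g′ y) (g y))))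

-- The root a gives f = (y - a) g. At y = a + 1 + n the factor y - a = n + 1 is invertible, so g
-- vanishes at a + 1, a + 2, ...; this is the hypothesis for g with base point a + 1, which is why a
-- is free.
polynomial-roots : ∀ d {f} a → Polynomial d f → (∀ n → f (a ℚ.+ fromℕ n) ≡ 0ℚ) → ∀ y → f y ≡ 0ℚ
polynomial-roots zero    a p roots y = p y
polynomial-roots (suc d) {f} a p roots y with p a
... | g , q , f≡ = begin
  f y                             ≡⟨ f≡ y ⟩
  f a ℚ.+ (y ℚ.- a) ℚ.* g y       ≡⟨ cong₂ (λ r s → r ℚ.+ (y ℚ.- a) ℚ.* s) fa≡0 (polynomial-roots d (a ℚ.+ 1ℚ) q groots y) ⟩
  0ℚ ℚ.+ (y ℚ.- a) ℚ.* 0ℚ         ≡⟨ solve 1 (λ d → con 0ℚ :+ d :* con 0ℚ := con 0ℚ) refl (y ℚ.- a) ⟩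
  0ℚ                              ∎
  where
  open ≡-Reasoning
  fa≡0 : f a ≡ 0ℚ
  fa≡0 = trans (cong f (sym (ℚₚ.+-identityʳ a))) (roots 0)
  groots : ∀ n → g (a ℚ.+ 1ℚ ℚ.+ fromℕ n) ≡ 0ℚ
  groots n = begin
    g b                          ≡⟨ solve 1 (λ r → r := con 1ℚ :* r) refl (g b) ⟩
    1ℚ ℚ.* g b                   ≡⟨ cong (ℚ._* g b) (sym (trans (ℚₚ.*-comm (+ 1 ℚ./ suc n) (fromℕ (suc n))) (fromℕ-inverse (suc n)))) ⟩
    (+ 1 ℚ./ suc n) ℚ.* fromℕ (suc n) ℚ.* g b
      ≡⟨ ℚₚ.*-assoc (+ 1 ℚ./ suc n) (fromℕ (suc n)) (g b) ⟩
    (+ 1 ℚ./ suc n) ℚ.* (fromℕ (suc n) ℚ.* g b)   ≡⟨ cong ((+ 1 ℚ./ suc n) ℚ.*_) N*gb≡0 ⟩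
    (+ 1 ℚ./ suc n) ℚ.* 0ℚ       ≡⟨ ℚₚ.*-zeroʳ (+ 1 ℚ./ suc n) ⟩
    0ℚ                           ∎
    where
    b = a ℚ.+ 1ℚ ℚ.+ fromℕ n
    a+N≡b : a ℚ.+ fromℕ (suc n) ≡ b
    a+N≡b = trans (cong (a ℚ.+_) (fromℕ-suc n)) (sym (ℚₚ.+-assoc a 1ℚ (fromℕ n)))
    N*gb≡0 : fromℕ (suc n) ℚ.* g b ≡ 0ℚ
    N*gb≡0 = begin
      fromℕ (suc n) ℚ.* g b                      ≡⟨ cong (ℚ._* g b) (fromℕ-suc n) ⟩
      (1ℚ ℚ.+ fromℕ n) ℚ.* g b                   ≡⟨ solve 3 (λ a n g → (con 1ℚ :+ n) :* g := con 0ℚ :+ (a :+ con 1ℚ :+ n :- a) :* g) refl a (fromℕ n) (g b) ⟩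
      0ℚ ℚ.+ (b ℚ.- a) ℚ.* g b                   ≡⟨ cong (ℚ._+ (b ℚ.- a) ℚ.* g b) (sym fa≡0) ⟩
      f a ℚ.+ (b ℚ.- a) ℚ.* g b                  ≡⟨ sym (f≡ b) ⟩
      f b                                        ≡⟨ cong f (sym a+N≡b) ⟩
      f (a ℚ.+ fromℕ (suc n))                    ≡⟨ roots (suc n) ⟩
      0ℚ                                         ∎

-- Degree bounds become existential here: `polynomial-roots` has infinitely many roots at its
-- disposal and works for any bound.
∃-polynomial-^ : ∀ n → ∃ λ d → Polynomial d (λ y → y ℚΣ.^ n)
∃-polynomial-^ zero    = 1 , polynomial-const 1ℚ
∃-polynomial-^ (suc n) = let d , p = ∃-polynomial-^ n in 2 ℕ.+ d , polynomial-* {2} {d} {λ y → y} {λ y → y ℚΣ.^ n} polynomial-id p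

∃-polynomial-+ : ∀ {f g} → ∃ (λ d → Polynomial d f) → ∃ (λ d → Polynomial d g) → ∃ λ d → Polynomial d (λ y → f y ℚ.+ g y)
∃-polynomial-+ (d , p) (e , q) = d ℕ.⊔ e ,
  polynomial-+ (polynomial-weaken (ℕₚ.m≤m⊔n d e) p) (polynomial-weaken (ℕₚ.m≤n⊔m d e) q)

∃-polynomial-scale : ∀ c {f} → ∃ (λ d → Polynomial d f) → ∃ λ d → Polynomial d (λ y → c ℚ.* f y)
∃-polynomial-scale c {f} (d , p) = suc d , polynomial-* {1} {d} {λ _ → c} {f} (polynomial-const c) p

∃-polynomial-sum : ∀ n {f : Fin n → ℚ → ℚ} → (∀ i → ∃ λ d → Polynomial d (f i)) → ∃ λ d → Polynomial d (λ y → ℚΣ.sum (λ i → f i y))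
∃-polynomial-sum zero    h = 0 , λ _ → refl
∃-polynomial-sum (suc n) h = ∃-polynomial-+ (h zero) (∃-polynomial-sum n (h ∘ suc))

∃-polynomial-product : ∀ n {f : Fin n → ℚ → ℚ} → (∀ i → ∃ λ d → Polynomial d (f i)) → ∃ λ d → Polynomial d (λ y → ℚΣ.product (λ i → f i y))
∃-polynomial-product zero    h = 1 , polynomial-const 1ℚ
∃-polynomial-product (suc n) h =
  let d , p = h zero ; e , q = ∃-polynomial-product n (h ∘ suc) in d ℕ.+ e , polynomial-* p q

-- Expansion of the falling factorial in Bernoulli polynomials

stirlingBernoulliSum : ℕ → ℚ → ℚ
stirlingBernoulliSum n y =
  ℚΣ.sum {n} (λ i → (+ 1 ℚ./ suc (toℕ i)) ℚ.* fromℕ (stirling₁ (n ∸ 1) (toℕ i)) ℚ.* bernoulliSum (suc (toℕ i)) y)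

-- Right side of the identity in the overview as a function of y; the left side is
-- `fall (1ℚ ℚ.- y) n`.
fallExpansion : ℕ → ℚ → ℚ
fallExpansion n y = δ n 1 ℚ.+ [-1]^ n ℚ.* fromℕ n ℚ.* stirlingBernoulliSum n y

fallExpansion-polynomial : ∀ n → ∃ λ d → Polynomial d (fallExpansion n)
fallExpansion-polynomial n = ∃-polynomial-+ (1 , polynomial-const (δ n 1))
  (∃-polynomial-scale ([-1]^ n ℚ.* fromℕ n) (∃-polynomial-sum n (λ i →
    ∃-polynomial-scale ((+ 1 ℚ./ suc (toℕ i)) ℚ.* fromℕ (stirling₁ (n ∸ 1) (toℕ i)))
      (∃-polynomial-sum (suc (toℕ i)) (λ j →
        ∃-polynomial-scale (fromℕ (suc (toℕ i) C suc (toℕ j)) ℚ.* bernoulli (suc (toℕ i) ∸ suc (toℕ j)))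
          (∃-polynomial-^ (suc (toℕ j))))))))

fall-polynomial : ∀ n → ∃ λ d → Polynomial d (λ y → fall (1ℚ ℚ.- y) n)
fall-polynomial n = ∃-polynomial-product n (λ i →
  ∃-polynomial-+ (∃-polynomial-+ (1 , polynomial-const 1ℚ) neg) (1 , polynomial-const (ℚ.- fromℕ (toℕ i))))
  where
  neg : ∃ λ d → Polynomial d (λ y → ℚ.- y)
  neg = 2 , λ a → (λ _ → ℚ.- 1ℚ) , polynomial-const (ℚ.- 1ℚ) ,
    λ y → solve 2 (λ y a → :- y := :- a :+ (y :- a) :* :- con 1ℚ) refl y a

-- Each Bernoulli difference (i + 1) yⁱ loses its factor to 1/(i + 1). What remains is the sum of
-- the [n, i] yⁱ, the rising factorial y (y + 1) ⋯ (y + n - 1), written as (-1)ⁿ times a falling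
-- factorial of -y.
stirlingBernoulliSum-+1 : ∀ n y →
  stirlingBernoulliSum (suc n) (y ℚ.+ 1ℚ) ≡ stirlingBernoulliSum (suc n) y ℚ.+ [-1]^ n ℚ.* fall (ℚ.- y) n
stirlingBernoulliSum-+1 n y = begin
  stirlingBernoulliSum (suc n) (y ℚ.+ 1ℚ)
    ≡⟨ sum-cong-≗ (λ (i : Fin (suc n)) → term (toℕ i)) ⟩
  ℚΣ.sum {suc n} (λ i → (+ 1 ℚ./ suc (toℕ i)) ℚ.* fromℕ (stirling₁ n (toℕ i)) ℚ.* bernoulliSum (suc (toℕ i)) y
    ℚ.+ fromℕ (stirling₁ n (toℕ i)) ℚ.* y ℚΣ.^ toℕ i)
    ≡⟨ sum-distrib-+ {suc n} (λ i → (+ 1 ℚ./ suc (toℕ i)) ℚ.* fromℕ (stirling₁ n (toℕ i)) ℚ.* bernoulliSum (suc (toℕ i)) y)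
         (λ i → fromℕ (stirling₁ n (toℕ i)) ℚ.* y ℚΣ.^ toℕ i) ⟩
  stirlingBernoulliSum (suc n) y ℚ.+ ℚΣ.sum {suc n} (λ i → fromℕ (stirling₁ n (toℕ i)) ℚ.* y ℚΣ.^ toℕ i)
    ≡⟨ cong (stirlingBernoulliSum (suc n) y ℚ.+_) (stirling₁-fall n (suc n) (ℕₚ.n<1+n n) y) ⟩
  stirlingBernoulliSum (suc n) y ℚ.+ [-1]^ n ℚ.* fall (ℚ.- y) n ∎
  where
  open ≡-Reasoning
  term : ∀ i → (+ 1 ℚ./ suc i) ℚ.* fromℕ (stirling₁ n i) ℚ.* bernoulliSum (suc i) (y ℚ.+ 1ℚ) ≡
    (+ 1 ℚ./ suc i) ℚ.* fromℕ (stirling₁ n i) ℚ.* bernoulliSum (suc i) y ℚ.+ fromℕ (stirling₁ n i) ℚ.* y ℚΣ.^ i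
  term i = begin
    w ℚ.* s ℚ.* bernoulliSum (suc i) (y ℚ.+ 1ℚ)    ≡⟨ cong (w ℚ.* s ℚ.*_) (bernoulliSum-+1 i y) ⟩
    w ℚ.* s ℚ.* (b ℚ.+ m ℚ.* p)                    ≡⟨ solve 5 (λ w s b m p → w :* s :* (b :+ m :* p) := w :* s :* b :+ m :* w :* (s :* p)) refl w s b m p ⟩
    w ℚ.* s ℚ.* b ℚ.+ m ℚ.* w ℚ.* (s ℚ.* p)        ≡⟨ cong (λ r → w ℚ.* s ℚ.* b ℚ.+ r ℚ.* (s ℚ.* p)) (fromℕ-inverse (suc i)) ⟩
    w ℚ.* s ℚ.* b ℚ.+ 1ℚ ℚ.* (s ℚ.* p)             ≡⟨ cong (w ℚ.* s ℚ.* b ℚ.+_) (ℚₚ.*-identityˡ (s ℚ.* p)) ⟩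
    w ℚ.* s ℚ.* b ℚ.+ s ℚ.* p                      ∎
    where
    w = + 1 ℚ./ suc i
    s = fromℕ (stirling₁ n i)
    b = bernoulliSum (suc i) y
    m = fromℕ (suc i)
    p = y ℚΣ.^ i

stirlingBernoulliSum-0 : ∀ n → stirlingBernoulliSum n 0ℚ ≡ 0ℚ
stirlingBernoulliSum-0 n = trans (sum-cong-≗ (λ (i : Fin n) →
  trans (cong ((+ 1 ℚ./ suc (toℕ i)) ℚ.* fromℕ (stirling₁ (n ∸ 1) (toℕ i)) ℚ.*_) (bernoulliSum-0 (suc (toℕ i))))
    (ℚₚ.*-zeroʳ ((+ 1 ℚ./ suc (toℕ i)) ℚ.* fromℕ (stirling₁ (n ∸ 1) (toℕ i)))))) (sum-0 n)

-- Both sides have the same value at 0 and the same difference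
-- (-1)ⁿ n y (y + 1) ⋯ (y + n − 2), so they agree on ℕ, hence everywhere.
fall≡fallExpansion : ∀ n y → fall (1ℚ ℚ.- y) (suc n) ≡ fallExpansion (suc n) y
fall≡fallExpansion n y =
  let d , p = ∃-polynomial-+ (fall-polynomial (suc n)) (∃-polynomial-scale (ℚ.- 1ℚ) (fallExpansion-polynomial (suc n)))
  in begin
    L y                                ≡⟨ solve 2 (λ l r → l := l :+ :- con 1ℚ :* r :+ r) refl (L y) (R y) ⟩
    L y ℚ.+ ℚ.- 1ℚ ℚ.* R y ℚ.+ R y     ≡⟨ cong (ℚ._+ R y) (polynomial-roots d 0ℚ p roots y) ⟩
    0ℚ ℚ.+ R y                         ≡⟨ ℚₚ.+-identityˡ (R y) ⟩
    R y                                ∎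
  where
  open ≡-Reasoning
  L R : ℚ → ℚ
  L y = fall (1ℚ ℚ.- y) (suc n)
  R y = fallExpansion (suc n) y
  σ = [-1]^ n
  N = fromℕ n
  -- The products at y + 1 and at y share the factors -y, ..., -y - n + 1. The remaining ones, -y -
  -- n and 1 - y, differ by n + 1.
  L-+1 : ∀ y → L (y ℚ.+ 1ℚ) ≡ L y ℚ.- fromℕ (suc n) ℚ.* fall (ℚ.- y) n
  L-+1 y = begin
    fall (1ℚ ℚ.- (y ℚ.+ 1ℚ)) (suc n)      ≡⟨ cong (λ z → fall z (suc n)) (solve 1 (λ y → con 1ℚ :- (y :+ con 1ℚ) := :- y) refl y) ⟩
    fall (ℚ.- y) (suc n)                  ≡⟨ fall-sucʳ (ℚ.- y) n ⟩
    F ℚ.* (ℚ.- y ℚ.- N)                   ≡⟨ solve 3 (λ F y N → F :* (:- y :- N) := (con 1ℚ :- y) :* F :- (con 1ℚ :+ N) :* F) refl F y N ⟩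
    (1ℚ ℚ.- y) ℚ.* F ℚ.- (1ℚ ℚ.+ N) ℚ.* F
      ≡⟨ cong₂ (λ p q → (1ℚ ℚ.- y) ℚ.* p ℚ.- q ℚ.* F) (cong (λ z → fall z n) (solve 1 (λ y → :- y := con 1ℚ :- y :- con 1ℚ) refl y)) (sym (fromℕ-suc n)) ⟩
    (1ℚ ℚ.- y) ℚ.* fall (1ℚ ℚ.- y ℚ.- 1ℚ) n ℚ.- fromℕ (suc n) ℚ.* F
      ≡⟨ cong (ℚ._- fromℕ (suc n) ℚ.* F) (sym (fall-sucˡ (1ℚ ℚ.- y) n)) ⟩
    L y ℚ.- fromℕ (suc n) ℚ.* F           ∎
    where F = fall (ℚ.- y) n
  R-+1 : ∀ y → R (y ℚ.+ 1ℚ) ≡ R y ℚ.- fromℕ (suc n) ℚ.* fall (ℚ.- y) n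
  R-+1 y = begin
    d ℚ.+ [-1]^ (suc n) ℚ.* M ℚ.* stirlingBernoulliSum (suc n) (y ℚ.+ 1ℚ)
      ≡⟨ cong (λ r → d ℚ.+ [-1]^ (suc n) ℚ.* M ℚ.* r) (stirlingBernoulliSum-+1 n y) ⟩
    d ℚ.+ (ℚ.- 1ℚ ℚ.* σ) ℚ.* M ℚ.* (S ℚ.+ σ ℚ.* F)
      ≡⟨ solve 5 (λ d σ M S F → d :+ (:- con 1ℚ :* σ) :* M :* (S :+ σ :* F) := d :+ (:- con 1ℚ :* σ) :* M :* S :- (σ :* σ) :* (M :* F)) refl d σ M S F ⟩
    R y ℚ.- (σ ℚ.* σ) ℚ.* (M ℚ.* F)
      ≡⟨ cong (λ r → R y ℚ.- r) (trans (cong (ℚ._* (M ℚ.* F)) ([-1]^-square n)) (ℚₚ.*-identityˡ (M ℚ.* F))) ⟩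
    R y ℚ.- M ℚ.* F ∎
    where
    d = δ (suc n) 1
    M = fromℕ (suc n)
    S = stirlingBernoulliSum (suc n) y
    F = fall (ℚ.- y) n
  -- From two factors on, the product at 1 contains 1 - 1.
  δ-fall : ∀ n → fall 1ℚ (suc n) ≡ δ (suc n) 1
  δ-fall zero    = refl
  δ-fall (suc n) = trans (cong (λ r → 1ℚ ℚ.* r) (ℚₚ.*-zeroˡ (ℚΣ.product {n} (λ i → 1ℚ ℚ.- fromℕ (suc (suc (toℕ i))))))) refl
  agree : ∀ m → L (fromℕ m) ≡ R (fromℕ m)
  agree zero    = trans (δ-fall n) (sym (begin
    d ℚ.+ c ℚ.* stirlingBernoulliSum (suc n) 0ℚ   ≡⟨ cong (λ r → d ℚ.+ c ℚ.* r) (stirlingBernoulliSum-0 (suc n)) ⟩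
    d ℚ.+ c ℚ.* 0ℚ                                ≡⟨ solve 2 (λ d c → d :+ c :* con 0ℚ := d) refl d c ⟩
    d                                             ∎))
    where
    d = δ (suc n) 1
    c = [-1]^ (suc n) ℚ.* fromℕ (suc n)
  agree (suc m) = begin
    L (fromℕ (suc m))                                        ≡⟨ cong L m+1 ⟩
    L (fromℕ m ℚ.+ 1ℚ)                                       ≡⟨ L-+1 (fromℕ m) ⟩
    L (fromℕ m) ℚ.- fromℕ (suc n) ℚ.* fall (ℚ.- fromℕ m) n   ≡⟨ cong (ℚ._- fromℕ (suc n) ℚ.* fall (ℚ.- fromℕ m) n) (agree m) ⟩
    R (fromℕ m) ℚ.- fromℕ (suc n) ℚ.* fall (ℚ.- fromℕ m) n   ≡⟨ sym (R-+1 (fromℕ m)) ⟩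
    R (fromℕ m ℚ.+ 1ℚ)                                       ≡⟨ cong R (sym m+1) ⟩
    R (fromℕ (suc m))                                        ∎
    where
    m+1 : fromℕ (suc m) ≡ fromℕ m ℚ.+ 1ℚ
    m+1 = trans (fromℕ-suc m) (ℚₚ.+-comm 1ℚ (fromℕ m))
  roots : ∀ m → L (0ℚ ℚ.+ fromℕ m) ℚ.+ ℚ.- 1ℚ ℚ.* R (0ℚ ℚ.+ fromℕ m) ≡ 0ℚ
  roots m = trans (cong (λ y → L y ℚ.+ ℚ.- 1ℚ ℚ.* R y) (ℚₚ.+-identityˡ (fromℕ m)))
    (trans (cong (ℚ._+ ℚ.- 1ℚ ℚ.* R (fromℕ m)) (agree m))
      (solve 1 (λ r → r :+ :- con 1ℚ :* r := con 0ℚ) refl (R (fromℕ m))))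

-- Asymptotic positivity of rational sequences

Eventually : (ℕ → Set) → Set
Eventually P = ∃ λ N → ∀ n → N ℕ.≤ n → P n

eventually-∩ : ∀ {P Q : ℕ → Set} → Eventually P → Eventually Q → Eventually (λ n → P n × Q n)
eventually-∩ (M , p) (N , q) = M ℕ.⊔ N , λ n M⊔N≤n →
  p n (ℕₚ.m⊔n≤o⇒m≤o M N M⊔N≤n) , q n (ℕₚ.m⊔n≤o⇒n≤o M N M⊔N≤n)

eventually-map : ∀ {P Q : ℕ → Set} → (∀ n → P n → Q n) → Eventually P → Eventually Q
eventually-map f (N , p) = N , λ n N≤n → f n (p n N≤n)

0≤-+ : ∀ {p q} → 0ℚ ℚ.≤ p → 0ℚ ℚ.≤ q → 0ℚ ℚ.≤ p ℚ.+ q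
0≤-+ = ℚₚ.+-mono-≤

0≤-* : ∀ {p q} → 0ℚ ℚ.≤ p → 0ℚ ℚ.≤ q → 0ℚ ℚ.≤ p ℚ.* q
0≤-* {p} {q} 0≤p 0≤q = subst (ℚ._≤ p ℚ.* q) (ℚₚ.*-zeroʳ p) (ℚₚ.*-monoˡ-≤-nonNeg p {{ℚ.nonNegative 0≤p}} 0≤q)

0<-* : ∀ {p q} → 0ℚ ℚ.< p → 0ℚ ℚ.< q → 0ℚ ℚ.< p ℚ.* q
0<-* {p} {q} 0<p 0<q = subst (ℚ._< p ℚ.* q) (ℚₚ.*-zeroʳ p) (ℚₚ.*-monoʳ-<-pos p {{ℚ.positive 0<p}} 0<q)

≤⇒0≤ : ∀ {p q} → p ℚ.≤ q → 0ℚ ℚ.≤ q ℚ.- p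
≤⇒0≤ {p} {q} p≤q = subst (ℚ._≤ q ℚ.- p) (ℚₚ.+-inverseʳ p) (ℚₚ.+-monoˡ-≤ (ℚ.- p) p≤q)

0≤⇒≤ : ∀ {p q} → 0ℚ ℚ.≤ q ℚ.- p → p ℚ.≤ q
0≤⇒≤ {p} {q} 0≤ = subst₂ ℚ._≤_ (ℚₚ.+-identityˡ p)
  (solve 2 (λ p q → q :- p :+ p := q) refl p q) (ℚₚ.+-monoˡ-≤ p 0≤)

<⇒0< : ∀ {p q} → p ℚ.< q → 0ℚ ℚ.< q ℚ.- p
<⇒0< {p} {q} p<q = subst (ℚ._< q ℚ.- p) (ℚₚ.+-inverseʳ p) (ℚₚ.+-monoˡ-< (ℚ.- p) p<q)

0<⇒< : ∀ {p q} → 0ℚ ℚ.< q ℚ.- p → p ℚ.< q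
0<⇒< {p} {q} 0< = subst₂ ℚ._<_ (ℚₚ.+-identityˡ p)
  (solve 2 (λ p q → q :- p :+ p := q) refl p q) (ℚₚ.+-monoˡ-< p 0<)

0<⊓ : ∀ {p q} → 0ℚ ℚ.< p → 0ℚ ℚ.< q → 0ℚ ℚ.< p ℚ.⊓ q
0<⊓ {p} {q} 0<p 0<q with ℚₚ.⊓-sel p q
... | inj₁ eq = subst (0ℚ ℚ.<_) (sym eq) 0<p
... | inj₂ eq = subst (0ℚ ℚ.<_) (sym eq) 0<q

halve : ∀ ε → 0ℚ ℚ.< ε → ∃ λ η → 0ℚ ℚ.< η × η ℚ.+ η ≡ ε
halve ε 0<ε = ½ ℚ.* ε , 0<-* (ℚₚ.positive⁻¹ ½) 0<ε ,
  trans (sym (ℚₚ.*-distribʳ-+ ε ½ ½)) (ℚₚ.*-identityˡ ε)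

shrink : ∀ M ε → 0ℚ ℚ.≤ M → 0ℚ ℚ.< ε → ∃ λ η → 0ℚ ℚ.< η × M ℚ.* η ℚ.≤ ε
shrink M ε 0≤M 0<ε = η , 0<η , 0≤⇒≤ (subst (0ℚ ℚ.≤_) eq (ℚₚ.<⇒≤ 0<η))
  where
  -- The divisor `M + 1` stays positive when `M` = 0. With η = ε / (M + 1) one gets M η = ε - η,
  -- hence M η ≤ ε.
  M+1 = M ℚ.+ 1ℚ
  instance
    pos = ℚ.positive (ℚₚ.+-mono-≤-< 0≤M (ℚₚ.positive⁻¹ 1ℚ))
    nz  = ℚₚ.pos⇒nonZero M+1
  η = ℚ.1/ M+1 ℚ.* ε
  0<η : 0ℚ ℚ.< η
  0<η = 0<-* (ℚₚ.positive⁻¹ (ℚ.1/ M+1) {{ℚₚ.1/pos⇒pos M+1}}) 0<ε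
  eq : η ≡ ε ℚ.- M ℚ.* η
  eq = begin
    η                                ≡⟨ solve 2 (λ η M → η := (M :+ con 1ℚ) :* η :- M :* η) refl η M ⟩
    M+1 ℚ.* η ℚ.- M ℚ.* η            ≡⟨ cong (ℚ._- M ℚ.* η) (sym (ℚₚ.*-assoc M+1 (ℚ.1/ M+1) ε)) ⟩
    M+1 ℚ.* ℚ.1/ M+1 ℚ.* ε ℚ.- M ℚ.* η ≡⟨ cong (λ r → r ℚ.* ε ℚ.- M ℚ.* η) (ℚₚ.*-inverseʳ M+1) ⟩
    1ℚ ℚ.* ε ℚ.- M ℚ.* η             ≡⟨ cong (ℚ._- M ℚ.* η) (ℚₚ.*-identityˡ ε) ⟩
    ε ℚ.- M ℚ.* η                    ∎
    where open ≡-Reasoning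

-- The limit of s is ≥ 0.
record NonNeg (s : ℕ → ℚ) : Set where
  constructor mkNonNeg
  field
    eventually>- : ∀ ε → 0ℚ ℚ.< ε → Eventually (λ n → 0ℚ ℚ.< s n ℚ.+ ε)

-- Required of the factors in `nonNeg-*`: -1/n and n² both satisfy `NonNeg`, while their product -n
-- does not.
record Bounded (s : ℕ → ℚ) : Set where
  constructor mkBounded
  field
    bound   : ℚ
    0≤bound : 0ℚ ℚ.≤ bound
    bounds  : Eventually (λ n → ℚ.∣ s n ∣ ℚ.≤ bound)

bounded-const : ∀ c → Bounded (λ _ → c)
bounded-const c = mkBounded ℚ.∣ c ∣ (ℚₚ.0≤∣p∣ c) (0 , λ _ _ → ℚₚ.≤-refl)

bounded-seq : ∀ x → Bounded (seq x)
bounded-seq x = let N , M , 0≤M , h = eventuallyBounded (seq x) (cauchy x) in mkBounded M 0≤M (N , h)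

bounded-+ : ∀ {s t} → Bounded s → Bounded t → Bounded (λ n → s n ℚ.+ t n)
bounded-+ {s} {t} (mkBounded A 0≤A p) (mkBounded B 0≤B q) = mkBounded (A ℚ.+ B) (0≤-+ 0≤A 0≤B)
  (eventually-map (λ n (p , q) → ℚₚ.≤-trans (ℚₚ.∣p+q∣≤∣p∣+∣q∣ (s n) (t n)) (ℚₚ.+-mono-≤ p q)) (eventually-∩ p q))

bounded-neg : ∀ {s} → Bounded s → Bounded (λ n → ℚ.- s n)
bounded-neg {s} (mkBounded A 0≤A p) = mkBounded A 0≤A
  (eventually-map (λ n → subst (ℚ._≤ A) (sym (ℚₚ.∣-p∣≡∣p∣ (s n)))) p)

bounded-- : ∀ {s t} → Bounded s → Bounded t → Bounded (λ n → s n ℚ.- t n)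
bounded-- p q = bounded-+ p (bounded-neg q)

bounded-* : ∀ {s t} → Bounded s → Bounded t → Bounded (λ n → s n ℚ.* t n)
bounded-* {s} {t} (mkBounded A 0≤A p) (mkBounded B 0≤B q) = mkBounded (A ℚ.* B) (0≤-* 0≤A 0≤B)
  (eventually-map (λ n (p , q) → ℚₚ.≤-trans (ℚₚ.≤-reflexive (ℚₚ.∣p*q∣≡∣p∣*∣q∣ (s n) (t n)))
    (ℚₚ.≤-trans (ℚₚ.*-monoʳ-≤-nonNeg ℚ.∣ t n ∣ {{ℚ.nonNegative (ℚₚ.0≤∣p∣ (t n))}} p)
                (ℚₚ.*-monoˡ-≤-nonNeg A {{ℚ.nonNegative 0≤A}} q))) (eventually-∩ p q))

bounded-^ : ∀ {s} i → Bounded s → Bounded (λ n → s n ℚΣ.^ i)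
bounded-^ zero    p = bounded-const 1ℚ
bounded-^ (suc i) p = bounded-* p (bounded-^ i p)

nonNeg-resp : ∀ {s t} → s ≗ t → NonNeg s → NonNeg t
nonNeg-resp s≗t (mkNonNeg p) = mkNonNeg λ ε 0<ε → eventually-map (λ n → subst (λ r → 0ℚ ℚ.< r ℚ.+ ε) (s≗t n)) (p ε 0<ε)

nonNeg-const : ∀ {c} → 0ℚ ℚ.≤ c → NonNeg (λ _ → c)
nonNeg-const 0≤c = mkNonNeg λ ε 0<ε → 0 , λ _ _ → ℚₚ.+-mono-≤-< 0≤c 0<ε

nonNeg-+ : ∀ {s t} → NonNeg s → NonNeg t → NonNeg (λ n → s n ℚ.+ t n)
nonNeg-+ {s} {t} (mkNonNeg p) (mkNonNeg q) = mkNonNeg λ ε 0<ε →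
  let η , 0<η , η+η≡ε = halve ε 0<ε
  in eventually-map (λ n (p , q) → subst (0ℚ ℚ.<_)
       (trans (solve 3 (λ s t η → (s :+ η) :+ (t :+ η) := s :+ t :+ (η :+ η)) refl (s n) (t n) η)
              (cong (s n ℚ.+ t n ℚ.+_) η+η≡ε))
       (ℚₚ.+-mono-< p q)) (eventually-∩ (p η 0<η) (q η 0<η))

-- s t + ε = (s + η)(t + η) + (ε − η (s + t + η))
nonNeg-* : ∀ {s t} → Bounded s → Bounded t → NonNeg s → NonNeg t → NonNeg (λ n → s n ℚ.* t n)
nonNeg-* {s} {t} (mkBounded A 0≤A bs) (mkBounded B 0≤B bt) (mkNonNeg p) (mkNonNeg q) = mkNonNeg λ ε 0<ε →
  let η₀ , 0<η₀ , Kη₀≤ε = shrink K ε (0≤-+ (0≤-+ 0≤A 0≤B) (ℚₚ.nonNegative⁻¹ 1ℚ)) 0<ε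
      -- The cap at 1 gives s + t + η ≤ A + B + 1 = `K`, so that the loss η (s + t + η) is at most K
      -- η ≤ ε.
      η = η₀ ℚ.⊓ 1ℚ
      0<η = 0<⊓ 0<η₀ (ℚₚ.positive⁻¹ 1ℚ)
      Kη≤ε = ℚₚ.≤-trans (ℚₚ.*-monoˡ-≤-nonNeg K {{ℚ.nonNegative (0≤-+ (0≤-+ 0≤A 0≤B) (ℚₚ.nonNegative⁻¹ 1ℚ))}} (ℚₚ.p⊓q≤p η₀ 1ℚ)) Kη₀≤ε
  in eventually-map (λ n ((p , q) , (a , b)) → subst (0ℚ ℚ.<_)
       (solve 5 (λ s t η ε w → (s :+ η) :* (t :+ η) :+ ((ε :- w) :+ (w :- η :* (s :+ t :+ η))) := s :* t :+ ε)
          refl (s n) (t n) η ε (K ℚ.* η))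
       (ℚₚ.+-mono-<-≤ (0<-* p q) (0≤-+ (≤⇒0≤ Kη≤ε)
         (subst (0ℚ ℚ.≤_) (solve 5 (λ A B s t η → η :* ((A :- s) :+ (B :- t) :+ (con 1ℚ :- η)) := (A :+ B :+ con 1ℚ) :* η :- η :* (s :+ t :+ η)) refl A B (s n) (t n) η)
           (0≤-* (ℚₚ.<⇒≤ 0<η)
              (0≤-+ (0≤-+ (≤⇒0≤ (ℚₚ.≤-trans (p≤∣p∣ (s n)) a)) (≤⇒0≤ (ℚₚ.≤-trans (p≤∣p∣ (t n)) b))) (≤⇒0≤ (ℚₚ.p⊓q≤q η₀ 1ℚ))))))))
       (eventually-∩ (eventually-∩ (p η 0<η) (q η 0<η)) (eventually-∩ bs bt))
  where
  K = A ℚ.+ B ℚ.+ 1ℚ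
  p≤∣p∣ : ∀ p → p ℚ.≤ ℚ.∣ p ∣
  p≤∣p∣ p with ℚₚ.≤-total 0ℚ p
  ... | inj₁ 0≤p = ℚₚ.≤-reflexive (sym (ℚₚ.0≤p⇒∣p∣≡p 0≤p))
  ... | inj₂ p≤0 = ℚₚ.≤-trans p≤0 (ℚₚ.0≤∣p∣ p)

≤⇒nonNeg : ∀ {x y} → x ≤ y → NonNeg (λ n → seq y n ℚ.- seq x n)
≤⇒nonNeg {x} {y} (mk≤ h) = mkNonNeg λ ε 0<ε → eventually-map (λ n x<y+ε → subst (0ℚ ℚ.<_)
  (solve 3 (λ x y ε → y :+ ε :- x := y :- x :+ ε) refl (seq x n) (seq y n) ε) (<⇒0< x<y+ε)) (h ε 0<ε)

∣p∣<q⇒p<q : ∀ {p q} → ℚ.∣ p ∣ ℚ.< q → p ℚ.< q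
∣p∣<q⇒p<q {p} h with ℚₚ.≤-total 0ℚ p
... | inj₁ 0≤p = subst (ℚ._< _) (ℚₚ.0≤p⇒∣p∣≡p 0≤p) h
... | inj₂ p≤0 = ℚₚ.≤-<-trans p≤0 (ℚₚ.≤-<-trans (ℚₚ.0≤∣p∣ p) h)

≈⇒nonNeg : ∀ {x y} → x ≈ y → NonNeg (λ n → seq y n ℚ.- seq x n)
≈⇒nonNeg {x} {y} (mk≈ h) = mkNonNeg λ ε 0<ε → eventually-map (λ n ∣x-y∣<ε → subst (0ℚ ℚ.<_)
  (solve 3 (λ x y ε → ε :- (x :- y) := y :- x :+ ε) refl (seq x n) (seq y n) ε) (<⇒0< (∣p∣<q⇒p<q ∣x-y∣<ε))) (h ε 0<ε)

≈-sym : ∀ {x y} → x ≈ y → y ≈ x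
≈-sym {x} {y} (mk≈ h) = mk≈ λ ε 0<ε → eventually-map (λ n → subst (ℚ._< ε)
  (trans (sym (ℚₚ.∣-p∣≡∣p∣ (seq x n ℚ.- seq y n)))
    (cong ℚ.∣_∣ (solve 2 (λ x y → :- (x :- y) := y :- x) refl (seq x n) (seq y n))))) (h ε 0<ε)

≗⇒≈ : ∀ {x y} → seq x ≗ seq y → x ≈ y
≗⇒≈ {x} {y} h = mk≈ λ ε 0<ε → 0 , λ n _ → subst (ℚ._< ε)
  (sym (cong ℚ.∣_∣ (trans (cong (ℚ._- seq y n) (h n)) (ℚₚ.+-inverseʳ (seq y n))))) 0<ε

∣∣≤-fromℚ : ∀ {x e} → NonNeg (λ n → e ℚ.- seq x n) → NonNeg (λ n → e ℚ.+ seq x n) → ∣ x ∣ ≤ fromℚ e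
∣∣≤-fromℚ {x} {e} (mkNonNeg p) (mkNonNeg q) = mk≤ λ ε 0<ε → eventually-map (λ n (p , q) → bound ε (seq x n) p q) (eventually-∩ (p ε 0<ε) (q ε 0<ε))
  where
  bound : ∀ ε r → 0ℚ ℚ.< e ℚ.- r ℚ.+ ε → 0ℚ ℚ.< e ℚ.+ r ℚ.+ ε → ℚ.∣ r ∣ ℚ.< e ℚ.+ ε
  bound ε r p q with ℚₚ.∣p∣≡p∨∣p∣≡-p r
  ... | inj₁ eq = subst (ℚ._< e ℚ.+ ε) (sym eq) (0<⇒< (subst (0ℚ ℚ.<_) (solve 3 (λ e r ε → e :- r :+ ε := e :+ ε :- r) refl e r ε) p))
  ... | inj₂ eq = subst (ℚ._< e ℚ.+ ε) (sym eq) (0<⇒< (subst (0ℚ ℚ.<_) (solve 3 (λ e r ε → e :+ r :+ ε := e :+ ε :- :- r) refl e r ε) q))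

-- Monotonicity and convexity of powers

nonNeg-^ : ∀ {s} i → Bounded s → NonNeg s → NonNeg (λ n → s n ℚΣ.^ i)
nonNeg-^ zero    b p = nonNeg-const (ℚₚ.nonNegative⁻¹ 1ℚ)
nonNeg-^ (suc i) b p = nonNeg-* b (bounded-^ i b) p (nonNeg-^ i b p)

module _ {u v : ℕ → ℚ} (u-bdd : Bounded u) (v-bdd : Bounded v)
         (0≤u : NonNeg u) (u≤v : NonNeg (λ n → v n ℚ.- u n)) where

  0≤v : NonNeg v
  0≤v = nonNeg-resp (λ n → solve 2 (λ u v → u :+ (v :- u) := v) refl (u n) (v n)) (nonNeg-+ 0≤u u≤v)

  v-u-bdd : Bounded (λ n → v n ℚ.- u n)
  v-u-bdd = bounded-- v-bdd u-bdd

  -- Induction through v vⁱ - u uⁱ = v (vⁱ - uⁱ) + (v - u) uⁱ.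
  ^-mono : ∀ i → NonNeg (λ n → v n ℚΣ.^ i ℚ.- u n ℚΣ.^ i)
  ^-mono zero    = nonNeg-const ℚₚ.≤-refl
  ^-mono (suc i) = nonNeg-resp
    (λ n → solve 4 (λ u v p q → v :* (q :- p) :+ (v :- u) :* p := v :* q :- u :* p) refl (u n) (v n) (u n ℚΣ.^ i) (v n ℚΣ.^ i))
    (nonNeg-+ (nonNeg-* v-bdd (bounded-- (bounded-^ i v-bdd) (bounded-^ i u-bdd)) 0≤v (^-mono i))
              (nonNeg-* v-u-bdd (bounded-^ i u-bdd) u≤v (nonNeg-^ i u-bdd 0≤u)))

  private
    [v-u][vⁱ-uⁱ]≥0 : ∀ i → NonNeg (λ n → (v n ℚ.- u n) ℚ.* (v n ℚΣ.^ i ℚ.- u n ℚΣ.^ i))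
    [v-u][vⁱ-uⁱ]≥0 i = nonNeg-* v-u-bdd (bounded-- (bounded-^ i v-bdd) (bounded-^ i u-bdd)) u≤v (^-mono i)

  -- Convexity: the graph of xⁱ⁺¹ lies above its tangent at u. Raising the exponent turns the defect
  -- into u times the old defect plus (v - u)(vⁱ⁺¹ - uⁱ⁺¹).
  ^-tangent-below : ∀ i → NonNeg (λ n →
    v n ℚΣ.^ suc i ℚ.- u n ℚΣ.^ suc i ℚ.- fromℕ (suc i) ℚ.* u n ℚΣ.^ i ℚ.* (v n ℚ.- u n))
  ^-tangent-below zero    = nonNeg-resp
    (λ n → solve 2 (λ u v → con 0ℚ := v :* con 1ℚ :- u :* con 1ℚ :- con 1ℚ :* con 1ℚ :* (v :- u)) refl (u n) (v n))
    (nonNeg-const ℚₚ.≤-refl)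
  ^-tangent-below (suc i) = nonNeg-resp
    (λ n → trans
      (solve 5 (λ u v p q N → u :* (v :* q :- u :* p :- N :* p :* (v :- u)) :+ (v :- u) :* (v :* q :- u :* p)
                          := v :* (v :* q) :- u :* (u :* p) :- (con 1ℚ :+ N) :* (u :* p) :* (v :- u))
        refl (u n) (v n) (u n ℚΣ.^ i) (v n ℚΣ.^ i) (fromℕ (suc i)))
      (cong (λ r → v n ℚΣ.^ suc (suc i) ℚ.- u n ℚΣ.^ suc (suc i) ℚ.- r ℚ.* u n ℚΣ.^ suc i ℚ.* (v n ℚ.- u n)) (sym (fromℕ-suc (suc i)))))
    (nonNeg-+
      (nonNeg-* u-bdd (bounded-- (bounded-- (bounded-^ (suc i) v-bdd) (bounded-^ (suc i) u-bdd))
                        (bounded-* (bounded-* (bounded-const (fromℕ (suc i))) (bounded-^ i u-bdd)) v-u-bdd)) 0≤u (^-tangent-below i))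
      ([v-u][vⁱ-uⁱ]≥0 (suc i)))

  -- The same for the tangent at v: the new defect is v times the old one plus (v - u)(vⁱ⁺¹ - uⁱ⁺¹).
  ^-tangent-above : ∀ i → NonNeg (λ n →
    fromℕ (suc i) ℚ.* v n ℚΣ.^ i ℚ.* (v n ℚ.- u n) ℚ.- (v n ℚΣ.^ suc i ℚ.- u n ℚΣ.^ suc i))
  ^-tangent-above zero    = nonNeg-resp
    (λ n → solve 2 (λ u v → con 0ℚ := con 1ℚ :* con 1ℚ :* (v :- u) :- (v :* con 1ℚ :- u :* con 1ℚ)) refl (u n) (v n))
    (nonNeg-const ℚₚ.≤-refl)
  ^-tangent-above (suc i) = nonNeg-resp
    (λ n → trans
      (solve 5 (λ u v p q N → v :* (N :* q :* (v :- u) :- (v :* q :- u :* p)) :+ (v :- u) :* (v :* q :- u :* p)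
                          := (con 1ℚ :+ N) :* (v :* q) :* (v :- u) :- (v :* (v :* q) :- u :* (u :* p)))
        refl (u n) (v n) (u n ℚΣ.^ i) (v n ℚΣ.^ i) (fromℕ (suc i)))
      (cong (λ r → r ℚ.* v n ℚΣ.^ suc i ℚ.* (v n ℚ.- u n) ℚ.- (v n ℚΣ.^ suc (suc i) ℚ.- u n ℚΣ.^ suc (suc i))) (sym (fromℕ-suc (suc i)))))
    (nonNeg-+
      (nonNeg-* v-bdd (bounded-- (bounded-* (bounded-* (bounded-const (fromℕ (suc i))) (bounded-^ i v-bdd)) v-u-bdd)
                        (bounded-- (bounded-^ (suc i) v-bdd) (bounded-^ (suc i) u-bdd))) 0≤v (^-tangent-above i))
      ([v-u][vⁱ-uⁱ]≥0 (suc i)))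

-- Riemann integrals

-- A name for x ↦ xⁱ, so that equality of powers is not decided by unfolding them to their Cauchy proofs.
power : ℕ → ℝ → ℝ
power i x = x ^ i

seq-power : ∀ i x n → seq (power i x) n ≡ seq x n ℚΣ.^ i
seq-power zero    x n = refl
seq-power (suc i) x n = cong (seq x n ℚ.*_) (seq-power i x n)

-- uⁱ ≤ tⁱ ≤ vⁱ for a tag t in [u , v], and the convexity bounds
-- (i + 1) uⁱ (v − u) ≤ vⁱ⁺¹ − uⁱ⁺¹ ≤ (i + 1) vⁱ (v − u); the errors telescope.
module _ (i : ℕ) {d : ℚ} (0≤d : 0ℚ ℚ.≤ d) where

  private
    N = fromℕ (suc i)

    0≤N : 0ℚ ℚ.≤ N
    0≤N = ℚₚ.nonNegative⁻¹ N {{ℚₚ.normalize-nonNeg (suc i) 1}}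

  -- Deviation of a Riemann sum r from the integral of xⁱ over [a , b], multiplied by i + 1 to avoid
  -- a division.
  ^-error : ℝ → ℝ → (ℕ → ℚ) → ℕ → ℚ
  ^-error a b r n = N ℚ.* r n ℚ.- (seq b n ℚΣ.^ suc i ℚ.- seq a n ℚΣ.^ suc i)

  -- Mesh times the variation of the increasing function xⁱ over [a , b], again scaled by i + 1. It
  -- is additive over adjacent intervals, so the bounds of single steps add up to that of a
  -- partition.
  ^-tolerance : ℝ → ℝ → ℕ → ℚ
  ^-tolerance a b n = N ℚ.* d ℚ.* (seq b n ℚΣ.^ i ℚ.- seq a n ℚΣ.^ i)

  private
    b- : ∀ x y j → Bounded (λ n → seq y n ℚΣ.^ j ℚ.- seq x n ℚΣ.^ j)
    b- x y j = bounded-- (bounded-^ j (bounded-seq y)) (bounded-^ j (bounded-seq x))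

    scaled : ∀ {c s} → 0ℚ ℚ.≤ c → Bounded s → NonNeg s → NonNeg (λ n → c ℚ.* s n)
    scaled {c} 0≤c b p = nonNeg-* (bounded-const c) b (nonNeg-const 0≤c) p

    tolerance≥0 : ∀ {a b} → NonNeg (seq a) → NonNeg (λ n → seq b n ℚ.- seq a n) → NonNeg (^-tolerance a b)
    tolerance≥0 {a} {b} 0≤a a≤b = scaled (0≤-* 0≤N 0≤d) (b- a b i)
      (^-mono (bounded-seq a) (bounded-seq b) 0≤a a≤b i)

  module _ {a t v : ℝ} (0≤a : NonNeg (seq a)) (a≤t : NonNeg (λ n → seq t n ℚ.- seq a n)) (t≤v : NonNeg (λ n → seq v n ℚ.- seq t n))
           (mesh : NonNeg (λ n → d ℚ.- (seq v n ℚ.- seq a n))) where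

    private
      a≤v : NonNeg (λ n → seq v n ℚ.- seq a n)
      a≤v = nonNeg-resp (λ n → solve 3 (λ a t v → (t :- a) :+ (v :- t) := v :- a) refl (seq a n) (seq t n) (seq v n)) (nonNeg-+ a≤t t≤v)

      bv-a : Bounded (λ n → seq v n ℚ.- seq a n)
      bv-a = bounded-- (bounded-seq v) (bounded-seq a)

      slack : NonNeg (λ n → N ℚ.* ((seq v n ℚΣ.^ i ℚ.- seq a n ℚΣ.^ i) ℚ.* (d ℚ.- (seq v n ℚ.- seq a n))))
      slack = scaled 0≤N (bounded-* (b- a v i) (bounded-- (bounded-const d) bv-a))
        (nonNeg-* (b- a v i) (bounded-- (bounded-const d) bv-a) (^-mono (bounded-seq a) (bounded-seq v) 0≤a a≤v i) mesh)

      0≤t : NonNeg (seq t)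
      0≤t = 0≤v (bounded-seq a) (bounded-seq t) 0≤a a≤t

      gap : ∀ {x y} → NonNeg (seq x) → NonNeg (λ n → seq y n ℚ.- seq x n) →
        NonNeg (λ n → N ℚ.* ((seq y n ℚΣ.^ i ℚ.- seq x n ℚΣ.^ i) ℚ.* (seq v n ℚ.- seq a n)))
      gap {x} {y} 0≤x x≤y = scaled 0≤N (bounded-* (b- x y i) bv-a)
        (nonNeg-* (b- x y i) bv-a (^-mono (bounded-seq x) (bounded-seq y) 0≤x x≤y i) a≤v)

    -- Put w = v - a. The lower convexity bound gives an error of at most N (tⁱ - aⁱ) w, which is at
    -- most N (vⁱ - aⁱ) w since t ≤ v, and at most the tolerance since w ≤ d.
    step-error≤ : NonNeg (λ n → ^-tolerance a v n ℚ.- ^-error a v (λ n → seq t n ℚΣ.^ i ℚ.* (seq v n ℚ.- seq a n)) n)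
    step-error≤ = nonNeg-resp
      (λ n → solve 7 (λ N d w A T V D → N :* ((V :- A) :* (d :- w)) :+ (N :* ((V :- T) :* w) :+ (D :- N :* A :* w))
                 := N :* d :* (V :- A) :- (N :* (T :* w) :- D)) refl
           N d (seq v n ℚ.- seq a n) (seq a n ℚΣ.^ i) (seq t n ℚΣ.^ i) (seq v n ℚΣ.^ i) (seq v n ℚΣ.^ suc i ℚ.- seq a n ℚΣ.^ suc i))
      (nonNeg-+ slack (nonNeg-+ (gap {t} {v} 0≤t t≤v) (^-tangent-below (bounded-seq a) (bounded-seq v) 0≤a a≤v i)))

    -- Mirror image: the upper convexity bound and a ≤ t bound the negated error by N (vⁱ - aⁱ) w.
    -step-error≤ : NonNeg (λ n → ^-tolerance a v n ℚ.+ ^-error a v (λ n → seq t n ℚΣ.^ i ℚ.* (seq v n ℚ.- seq a n)) n)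
    -step-error≤ = nonNeg-resp
      (λ n → solve 7 (λ N d w A T V D → N :* ((V :- A) :* (d :- w)) :+ (N :* ((T :- A) :* w) :+ (N :* V :* w :- D))
                 := N :* d :* (V :- A) :+ (N :* (T :* w) :- D)) refl
           N d (seq v n ℚ.- seq a n) (seq a n ℚΣ.^ i) (seq t n ℚΣ.^ i) (seq v n ℚΣ.^ i) (seq v n ℚΣ.^ suc i ℚ.- seq a n ℚΣ.^ suc i))
      (nonNeg-+ slack (nonNeg-+ (gap {a} {t} 0≤a a≤t) (^-tangent-above (bounded-seq a) (bounded-seq v) 0≤a a≤v i)))

  -- The two bounds together say that the absolute error is within the tolerance. In the empty
  -- partition the end points are equal only up to `≈`, so bⁱ⁺¹ - aⁱ⁺¹ is not literally 0: one bound
  -- uses a ≤ b, the other also b ≤ a.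
  riemannSum-^ : ∀ {a b} (P : TaggedPartition a b) → NonNeg (seq a) → MeshAtMost d P →
    NonNeg (λ n → ^-tolerance a b n ℚ.- ^-error a b (seq (riemannSum (power i) P)) n) ×
    NonNeg (λ n → ^-tolerance a b n ℚ.+ ^-error a b (seq (riemannSum (power i) P)) n)
  riemannSum-^ {a} {b} (done a≈b) 0≤a _ =
      nonNeg-resp (λ n → solve 3 (λ x N D → x :+ D := x :- (N :* con 0ℚ :- D)) refl
          (^-tolerance a b n) N (seq b n ℚΣ.^ suc i ℚ.- seq a n ℚΣ.^ suc i))
        (nonNeg-+ tol (^-mono (bounded-seq a) (bounded-seq b) 0≤a a≤b (suc i)))
    , nonNeg-resp (λ n → solve 4 (λ x N A B → x :+ (A :- B) := x :+ (N :* con 0ℚ :- (B :- A))) refl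
          (^-tolerance a b n) N (seq a n ℚΣ.^ suc i) (seq b n ℚΣ.^ suc i))
        (nonNeg-+ tol (^-mono (bounded-seq b) (bounded-seq a) (0≤v (bounded-seq a) (bounded-seq b) 0≤a a≤b) (≈⇒nonNeg (≈-sym a≈b)) (suc i)))
    where
    a≤b = ≈⇒nonNeg a≈b
    tol = tolerance≥0 {a} {b} 0≤a a≤b
  riemannSum-^ {a} {b} (step tag next a≤tag tag≤next P) 0≤a (mesh , meshes) =
      nonNeg-resp (λ n → trans
          (solve 9 (λ c N A V B T R A′ B′ → ((c :* (V :- A) :- (N :* T :- A′)) :+ (c :* (B :- V) :- (N :* R :- B′)))
                      := (c :* (B :- A) :- (N :* (T :+ R) :- (B′ :+ A′)))) refl
            (N ℚ.* d) N (seq a n ℚΣ.^ i) (seq next n ℚΣ.^ i) (seq b n ℚΣ.^ i)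
            (seq tag n ℚΣ.^ i ℚ.* (seq next n ℚ.- seq a n)) (seq rest n)
            (seq next n ℚΣ.^ suc i ℚ.- seq a n ℚΣ.^ suc i) (seq b n ℚΣ.^ suc i ℚ.- seq next n ℚΣ.^ suc i))
          (cong₂ (λ p q → ^-tolerance a b n ℚ.- (N ℚ.* p ℚ.- q)) (first n) (telescope n)))
        (nonNeg-+ (step-error≤ {a} {tag} {next} 0≤a a≤tag′ tag≤next′ mesh′) (proj₁ ih))
    , nonNeg-resp (λ n → trans
          (solve 9 (λ c N A V B T R A′ B′ → ((c :* (V :- A) :+ (N :* T :- A′)) :+ (c :* (B :- V) :+ (N :* R :- B′)))
                      := (c :* (B :- A) :+ (N :* (T :+ R) :- (B′ :+ A′)))) refl
            (N ℚ.* d) N (seq a n ℚΣ.^ i) (seq next n ℚΣ.^ i) (seq b n ℚΣ.^ i)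
            (seq tag n ℚΣ.^ i ℚ.* (seq next n ℚ.- seq a n)) (seq rest n)
            (seq next n ℚΣ.^ suc i ℚ.- seq a n ℚΣ.^ suc i) (seq b n ℚΣ.^ suc i ℚ.- seq next n ℚΣ.^ suc i))
          (cong₂ (λ p q → ^-tolerance a b n ℚ.+ (N ℚ.* p ℚ.- q)) (first n) (telescope n)))
        (nonNeg-+ (-step-error≤ {a} {tag} {next} 0≤a a≤tag′ tag≤next′ mesh′) (proj₂ ih))
    where
    rest = riemannSum (power i) P
    a≤tag′ = ≤⇒nonNeg a≤tag
    tag≤next′ = ≤⇒nonNeg tag≤next
    mesh′ : NonNeg (λ n → d ℚ.- (seq next n ℚ.- seq a n))
    mesh′ = ≤⇒nonNeg mesh
    0≤next : NonNeg (seq next)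
    0≤next = 0≤v (bounded-seq tag) (bounded-seq next) (0≤v (bounded-seq a) (bounded-seq tag) 0≤a a≤tag′) tag≤next′
    ih = riemannSum-^ P 0≤next meshes
    first : ∀ n → seq tag n ℚΣ.^ i ℚ.* (seq next n ℚ.- seq a n) ℚ.+ seq rest n ≡
                  seq (power i tag) n ℚ.* (seq next n ℚ.- seq a n) ℚ.+ seq rest n
    first n = cong (λ r → r ℚ.* (seq next n ℚ.- seq a n) ℚ.+ seq rest n) (sym (seq-power i tag n))
    telescope : ∀ n → (seq b n ℚΣ.^ suc i ℚ.- seq next n ℚΣ.^ suc i) ℚ.+ (seq next n ℚΣ.^ suc i ℚ.- seq a n ℚΣ.^ suc i) ≡
                      seq b n ℚΣ.^ suc i ℚ.- seq a n ℚΣ.^ suc i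
    telescope n = solve 3 (λ A V B → (B :- V) :+ (V :- A) := B :- A) refl
      (seq a n ℚΣ.^ suc i) (seq next n ℚΣ.^ suc i) (seq b n ℚΣ.^ suc i)

-- On [0 , 1], dividing `riemannSum-^` by i + 1 bounds the error by mesh · (1 - 0ⁱ), so δ = ε
-- suffices. As 0ⁱ is 1 for i = 0, it is kept symbolic, and the nonnegative term ε 0ⁱ is added to
-- reach ε.
hasIntegral-power : ∀ i → HasIntegral (power i) 0ℝ 1ℝ (fromℚ (+ 1 ℚ./ suc i))
hasIntegral-power i ε 0<ε = ε , 0<ε , λ P mesh →
  let p , q = riemannSum-^ i 0≤ε P (nonNeg-const ℚₚ.≤-refl) mesh
      R     = riemannSum (power i) P
  in ∣∣≤-fromℚ
       (nonNeg-resp (λ n → trans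
           (solve 7 (λ c N z o o′ r ε → c :* (N :* ε :* (o :- z) :- (N :* r :- (o′ :- con 0ℚ :* z))) :+ ε :* z
              := N :* c :* (ε :* (o :- z) :- r) :+ c :* o′ :+ ε :* z) refl
             c N (0ℚ ℚΣ.^ i) (1ℚ ℚΣ.^ i) (1ℚ ℚΣ.^ suc i) (seq R n) ε)
           (trans (simplify (λ k o o′ → k ℚ.* (ε ℚ.* (o ℚ.- 0ℚ ℚΣ.^ i) ℚ.- seq R n) ℚ.+ c ℚ.* o′ ℚ.+ ε ℚ.* 0ℚ ℚΣ.^ i))
             (solve 4 (λ c z r ε → con 1ℚ :* (ε :* (con 1ℚ :- z) :- r) :+ c :* con 1ℚ :+ ε :* z := ε :- (r :- c)) refl
               c (0ℚ ℚΣ.^ i) (seq R n) ε)))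
         (nonNeg-+ (scale (bounded-- bounded-tolerance (bounded-error R)) p) εz≥0))
       (nonNeg-resp (λ n → trans
           (solve 7 (λ c N z o o′ r ε → c :* (N :* ε :* (o :- z) :+ (N :* r :- (o′ :- con 0ℚ :* z))) :+ ε :* z
              := N :* c :* (ε :* (o :- z) :+ r) :- c :* o′ :+ ε :* z) refl
             c N (0ℚ ℚΣ.^ i) (1ℚ ℚΣ.^ i) (1ℚ ℚΣ.^ suc i) (seq R n) ε)
           (trans (simplify (λ k o o′ → k ℚ.* (ε ℚ.* (o ℚ.- 0ℚ ℚΣ.^ i) ℚ.+ seq R n) ℚ.- c ℚ.* o′ ℚ.+ ε ℚ.* 0ℚ ℚΣ.^ i))
             (solve 4 (λ c z r ε → con 1ℚ :* (ε :* (con 1ℚ :- z) :+ r) :- c :* con 1ℚ :+ ε :* z := ε :+ (r :- c)) refl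
               c (0ℚ ℚΣ.^ i) (seq R n) ε)))
         (nonNeg-+ (scale (bounded-+ bounded-tolerance (bounded-error R)) q) εz≥0))
  where
  c = + 1 ℚ./ suc i
  N = fromℕ (suc i)
  0≤ε = ℚₚ.<⇒≤ 0<ε
  0≤c : 0ℚ ℚ.≤ c
  0≤c = ℚₚ.nonNegative⁻¹ c {{ℚₚ.normalize-nonNeg 1 (suc i)}}
  bounded-tolerance : Bounded (^-tolerance i 0≤ε 0ℝ 1ℝ)
  bounded-tolerance = bounded-const (N ℚ.* ε ℚ.* (1ℚ ℚΣ.^ i ℚ.- 0ℚ ℚΣ.^ i))
  bounded-error : ∀ x → Bounded (^-error i 0≤ε 0ℝ 1ℝ (seq x))
  bounded-error x = bounded-- (bounded-* (bounded-const N) (bounded-seq x)) (bounded-const (1ℚ ℚΣ.^ suc i ℚ.- 0ℚ ℚΣ.^ suc i))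
  scale : ∀ {s} → Bounded s → NonNeg s → NonNeg (λ n → c ℚ.* s n)
  scale b p = nonNeg-* (bounded-const c) b (nonNeg-const 0≤c) p
  εz≥0 : NonNeg (λ _ → ε ℚ.* 0ℚ ℚΣ.^ i)
  εz≥0 = nonNeg-* (bounded-const ε) (bounded-const (0ℚ ℚΣ.^ i)) (nonNeg-const 0≤ε)
    (nonNeg-^ i (bounded-const 0ℚ) (nonNeg-const ℚₚ.≤-refl))
  simplify : ∀ (f : ℚ → ℚ → ℚ → ℚ) → f (N ℚ.* c) (1ℚ ℚΣ.^ i) (1ℚ ℚΣ.^ suc i) ≡ f 1ℚ 1ℚ 1ℚ
  simplify f = trans (cong (λ k → f k (1ℚ ℚΣ.^ i) (1ℚ ℚΣ.^ suc i)) (fromℕ-inverse (suc i)))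
    (cong₂ (f 1ℚ) (^-zeroˡ i) (^-zeroˡ (suc i)))

-- Linearity of the integral

meshAtMost-mono : ∀ {a b d e} → d ℚ.≤ e → (P : TaggedPartition a b) → MeshAtMost d P → MeshAtMost e P
meshAtMost-mono d≤e (done _)              m        = m
meshAtMost-mono {d = d} {e} d≤e (step {a} tag next _ _ P) (mk≤ h , m) = mk≤ (λ ε 0<ε →
  eventually-map (λ n p → ℚₚ.<-≤-trans p (ℚₚ.+-monoˡ-≤ ε d≤e)) (h ε 0<ε)) , meshAtMost-mono d≤e P m

riemannSum-linear : ∀ c f g {a b} (P : TaggedPartition a b) n →
  seq (riemannSum (λ t → c * f t + g t) P) n ≡ seq c n ℚ.* seq (riemannSum f P) n ℚ.+ seq (riemannSum g P) n
riemannSum-linear c f g (done _) n = solve 1 (λ c → con 0ℚ := c :* con 0ℚ :+ con 0ℚ) refl (seq c n)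
riemannSum-linear c f g (step {a} tag next _ _ P) n = trans
  (cong ((seq c n ℚ.* seq (f tag) n ℚ.+ seq (g tag) n) ℚ.* (seq next n ℚ.- seq a n) ℚ.+_) (riemannSum-linear c f g P n))
  (solve 6 (λ c f g w r s → (c :* f :+ g) :* w :+ (c :* r :+ s) := c :* (f :* w :+ r) :+ (g :* w :+ s)) refl
    (seq c n) (seq (f tag) n) (seq (g tag) n) (seq next n ℚ.- seq a n) (seq (riemannSum f P) n) (seq (riemannSum g P) n))

hasIntegral-resp : ∀ {f a b I J} → seq I ≗ seq J → HasIntegral f a b I → HasIntegral f a b J
hasIntegral-resp {f} {I = I} {J} I≗J h ε 0<ε =
  let d , 0<d , close = h ε 0<ε
  in d , 0<d , λ P m → mk≤ λ η 0<η → eventually-map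
       (λ n → subst (λ r → ℚ.∣ seq (riemannSum f P) n ℚ.- r ∣ ℚ.< ε ℚ.+ η) (I≗J n)) (_≤_.below (close P m) η 0<η)

∣kx+y∣<2q : ∀ k x y {M p q} → 0ℚ ℚ.≤ M → M ℚ.* p ℚ.≤ q → ℚ.∣ k ∣ ℚ.≤ M → ℚ.∣ x ∣ ℚ.< p → ℚ.∣ y ∣ ℚ.< q →
  ℚ.∣ k ℚ.* x ℚ.+ y ∣ ℚ.< q ℚ.+ q
∣kx+y∣<2q k x y {M} {p} {q} 0≤M Mp≤q k≤M x<p y<q = begin-strict
  ℚ.∣ k ℚ.* x ℚ.+ y ∣               ≤⟨ ℚₚ.∣p+q∣≤∣p∣+∣q∣ (k ℚ.* x) y ⟩
  ℚ.∣ k ℚ.* x ∣ ℚ.+ ℚ.∣ y ∣         ≡⟨ cong (ℚ._+ ℚ.∣ y ∣) (ℚₚ.∣p*q∣≡∣p∣*∣q∣ k x) ⟩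
  ℚ.∣ k ∣ ℚ.* ℚ.∣ x ∣ ℚ.+ ℚ.∣ y ∣   ≤⟨ ℚₚ.+-monoˡ-≤ ℚ.∣ y ∣ (ℚₚ.*-monoʳ-≤-nonNeg ℚ.∣ x ∣ {{ℚ.nonNegative (ℚₚ.0≤∣p∣ x)}} k≤M) ⟩
  M ℚ.* ℚ.∣ x ∣ ℚ.+ ℚ.∣ y ∣         ≤⟨ ℚₚ.+-monoˡ-≤ ℚ.∣ y ∣ (ℚₚ.*-monoˡ-≤-nonNeg M {{ℚ.nonNegative 0≤M}} (ℚₚ.<⇒≤ x<p)) ⟩
  M ℚ.* p ℚ.+ ℚ.∣ y ∣               ≤⟨ ℚₚ.+-monoˡ-≤ ℚ.∣ y ∣ Mp≤q ⟩
  q ℚ.+ ℚ.∣ y ∣                     <⟨ ℚₚ.+-monoʳ-< q y<q ⟩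
  q ℚ.+ q                           ∎
  where open ℚₚ.≤-Reasoning

hasIntegral-linear : ∀ c {f g a b I J} → HasIntegral f a b I → HasIntegral g a b J →
  HasIntegral (λ t → c * f t + g t) a b (c * I + J)
hasIntegral-linear c {f} {g} {a} {b} {I} {J} F G ε 0<ε =
  let ε₁ , 0<ε₁ , ε₁+ε₁≡ε = halve ε 0<ε
      ε₂ , 0<ε₂ , Mε₂≤ε₁  = shrink M ε₁ 0≤M 0<ε₁
      d₁ , 0<d₁ , close₁  = F ε₂ 0<ε₂
      d₂ , 0<d₂ , close₂  = G ε₁ 0<ε₁
  in d₁ ℚ.⊓ d₂ , 0<⊓ 0<d₁ 0<d₂ , λ P m → mk≤ λ η 0<η →
       -- The order on reals carries its own slack η, which is divided between the two integrals
       -- just as ε was.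
       let η₁ , 0<η₁ , η₁+η₁≡η = halve η 0<η
           η₂ , 0<η₂ , Mη₂≤η₁  = shrink M η₁ 0≤M 0<η₁
       in eventually-map
            (λ n (k , p , q) → subst₂ (λ x y → ℚ.∣ x ∣ ℚ.< y)
              (trans (solve 5 (λ c r I s J → c :* (r :- I) :+ (s :- J) := c :* r :+ s :- (c :* I :+ J)) refl
                        (seq c n) (seq (riemannSum f P) n) (seq I n) (seq (riemannSum g P) n) (seq J n))
                     (cong (ℚ._- (seq c n ℚ.* seq I n ℚ.+ seq J n)) (sym (riemannSum-linear c f g P n))))
              (trans (solve 2 (λ e h → e :+ h :+ (e :+ h) := e :+ e :+ (h :+ h)) refl ε₁ η₁) (cong₂ ℚ._+_ ε₁+ε₁≡ε η₁+η₁≡η))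
              (∣kx+y∣<2q (seq c n) (seq (riemannSum f P) n ℚ.- seq I n) (seq (riemannSum g P) n ℚ.- seq J n) 0≤M
                (ℚₚ.≤-trans (ℚₚ.≤-reflexive (ℚₚ.*-distribˡ-+ M ε₂ η₂)) (ℚₚ.+-mono-≤ Mε₂≤ε₁ Mη₂≤η₁)) k p q))
            (eventually-∩ bounds (eventually-∩
              (_≤_.below (close₁ P (meshAtMost-mono (ℚₚ.p⊓q≤p d₁ d₂) P m)) η₂ 0<η₂)
              (_≤_.below (close₂ P (meshAtMost-mono (ℚₚ.p⊓q≤q d₁ d₂) P m)) η₁ 0<η₁)))
  where
  open Bounded (bounded-seq c) renaming (bound to M; 0≤bound to 0≤M)

riemannSum-0 : ∀ {a b} (P : TaggedPartition a b) n → seq (riemannSum (λ _ → 0ℝ) P) n ≡ 0ℚ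
riemannSum-0 (done _) n = refl
riemannSum-0 (step {a} tag next _ _ P) n = trans
  (cong (0ℚ ℚ.* (seq next n ℚ.- seq a n) ℚ.+_) (riemannSum-0 P n))
  (solve 1 (λ w → con 0ℚ :* w :+ con 0ℚ := con 0ℚ) refl (seq next n ℚ.- seq a n))

hasIntegral-0 : ∀ {a b} → HasIntegral (λ _ → 0ℝ) a b 0ℝ
hasIntegral-0 ε 0<ε = ε , 0<ε , λ P _ → ∣∣≤-fromℚ
  (nonNeg-resp (λ n → trans (solve 1 (λ ε → ε := ε :- (con 0ℚ :- con 0ℚ)) refl ε)
    (cong (λ r → ε ℚ.- (r ℚ.- 0ℚ)) (sym (riemannSum-0 P n)))) (nonNeg-const (ℚₚ.<⇒≤ 0<ε)))
  (nonNeg-resp (λ n → trans (solve 1 (λ ε → ε := ε :+ (con 0ℚ :- con 0ℚ)) refl ε)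
    (cong (λ r → ε ℚ.+ (r ℚ.- 0ℚ)) (sym (riemannSum-0 P n)))) (nonNeg-const (ℚₚ.<⇒≤ 0<ε)))

-- Iterated integrals

≈-resp : ∀ {x x′ y y′} → seq x ≗ seq x′ → seq y ≗ seq y′ → x ≈ y → x′ ≈ y′
≈-resp p q (mk≈ h) = mk≈ λ ε 0<ε → eventually-map
  (λ n → subst₂ (λ x y → ℚ.∣ x ℚ.- y ∣ ℚ.< ε) (p n) (q n)) (h ε 0<ε)

≈-linear : ∀ c {x x′ y y′} → x ≈ x′ → y ≈ y′ → c * x + y ≈ c * x′ + y′
≈-linear c {x} {x′} {y} {y′} (mk≈ p) (mk≈ q) = mk≈ λ ε 0<ε →
  let ε₁ , 0<ε₁ , ε₁+ε₁≡ε = halve ε 0<ε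
      ε₂ , 0<ε₂ , Mε₂≤ε₁  = shrink M ε₁ 0≤M 0<ε₁
  in eventually-map
       (λ n (k , p , q) → subst₂ (λ x y → ℚ.∣ x ∣ ℚ.< y)
         (solve 5 (λ c r I s J → c :* (r :- I) :+ (s :- J) := c :* r :+ s :- (c :* I :+ J)) refl
            (seq c n) (seq x n) (seq x′ n) (seq y n) (seq y′ n))
         ε₁+ε₁≡ε
         (∣kx+y∣<2q (seq c n) (seq x n ℚ.- seq x′ n) (seq y n ℚ.- seq y′ n) 0≤M Mε₂≤ε₁ k p q))
       (eventually-∩ bounds (eventually-∩ (p ε₂ 0<ε₂) (q ε₁ 0<ε₁)))
  where open Bounded (bounded-seq c) renaming (bound to M; 0≤bound to 0≤M)

-- Termwise equality suffices because the rewritings of integrands are ring identities over ℚ at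
-- each index. The intermediate function `g` of each level is kept.
iterated-resp : ∀ k {f f′ : Vec ℝ k → ℝ} {I J} → (∀ ts → seq (f ts) ≗ seq (f′ ts)) → seq I ≗ seq J →
  HasIteratedIntegral k f I → HasIteratedIntegral k f′ J
iterated-resp zero    f≗f′ I≗J h           = ≈-resp (f≗f′ []) I≗J h
iterated-resp (suc k) {f} {f′} {I} {J} f≗f′ I≗J (g , h , i) = g ,
  (λ t 0≤t t≤1 → iterated-resp k {λ ts → f (ts ∷ʳ t)} {λ ts → f′ (ts ∷ʳ t)} {g t} {g t} (λ ts → f≗f′ (ts ∷ʳ t)) (λ _ → refl) (h t 0≤t t≤1)) ,
  hasIntegral-resp {g} {0ℝ} {1ℝ} {I} {J} I≗J i

iterated-0 : ∀ k → HasIteratedIntegral k (λ _ → 0ℝ) 0ℝ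
iterated-0 zero    = ≗⇒≈ λ _ → refl
iterated-0 (suc k) = (λ _ → 0ℝ) , (λ _ _ _ → iterated-0 k) , hasIntegral-0

iterated-linear : ∀ k c {f g : Vec ℝ k → ℝ} {I J} → HasIteratedIntegral k f I → HasIteratedIntegral k g J →
  HasIteratedIntegral k (λ ts → c * f ts + g ts) (c * I + J)
iterated-linear zero    c {f} {g} {I} {J} p q = ≈-linear c {f []} {I} {g []} {J} p q
iterated-linear (suc k) c {f} {g} {I} {J} (F , p , P) (G , q , Q) = (λ t → c * F t + G t) ,
  (λ t 0≤t t≤1 → iterated-linear k c {λ ts → f (ts ∷ʳ t)} {λ ts → g (ts ∷ʳ t)} {F t} {G t} (p t 0≤t t≤1) (q t 0≤t t≤1)) ,
  hasIntegral-linear c {F} {G} {0ℝ} {1ℝ} {I} {J} P Q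

iterated-scale : ∀ k c {f : Vec ℝ k → ℝ} {I} → HasIteratedIntegral k f I → HasIteratedIntegral k (λ ts → c * f ts) (c * I)
iterated-scale k c {f} {I} h = iterated-resp k {λ ts → c * f ts + 0ℝ} {λ ts → c * f ts} {c * I + 0ℝ} {c * I}
  (λ ts n → ℚₚ.+-identityʳ (seq c n ℚ.* seq (f ts) n)) (λ n → ℚₚ.+-identityʳ (seq c n ℚ.* seq I n))
  (iterated-linear k c {f} {λ _ → 0ℝ} {I} {0ℝ} h (iterated-0 k))

seq-sum : ∀ m (f : Fin m → ℝ) n → seq (sum f) n ≡ ℚΣ.sum (λ i → seq (f i) n)
seq-sum zero    f n = refl
seq-sum (suc m) f n = cong (seq (f zero) n ℚ.+_) (seq-sum m (f ∘ suc) n)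

seq-sum-suc : ∀ {m} (f : Fin (suc m) → ℝ) n → seq (f zero + sum (λ i → f (suc i))) n ≡ seq (sum f) n
seq-sum-suc f n = refl

iterated-sum : ∀ k m (c : Fin m → ℝ) {f : Fin m → Vec ℝ k → ℝ} {I : Fin m → ℝ} → (∀ i → HasIteratedIntegral k (f i) (I i)) →
  HasIteratedIntegral k (λ ts → sum (λ i → c i * f i ts)) (sum (λ i → c i * I i))
iterated-sum k zero    c h = iterated-0 k
iterated-sum k (suc m) c {f} {I} h = iterated-resp k
  {λ ts → c zero * f zero ts + sum (λ i → c (suc i) * f (suc i) ts)} {λ ts → sum (λ i → c i * f i ts)}
  {c zero * I zero + sum (λ i → c (suc i) * I (suc i))} {sum (λ i → c i * I i)}
  (λ ts → seq-sum-suc (λ i → c i * f i ts)) (seq-sum-suc (λ i → c i * I i))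
  (iterated-linear k (c zero) {f zero} {λ ts → sum (λ i → c (suc i) * f (suc i) ts)}
    {I zero} {sum (λ i → c (suc i) * I (suc i))} (h zero) (iterated-sum k m (c ∘ suc) {f ∘ suc} {I ∘ suc} (h ∘ suc)))

seq-Π-∷ʳ : ∀ {k} (ts : Vec ℝ k) t n → seq (Π (ts ∷ʳ t)) n ≡ seq t n ℚ.* seq (Π ts) n
seq-Π-∷ʳ []       t n = refl
seq-Π-∷ʳ (x ∷ ts) t n = trans (cong (seq x n ℚ.*_) (seq-Π-∷ʳ ts t n))
  (solve 3 (λ x t p → x :* (t :* p) := t :* (x :* p)) refl (seq x n) (seq t n) (seq (Π ts) n))

-- For fixed t the factor p t is a constant of the inner integral, whose value is therefore d · p t;
-- the outer integration then yields d · c.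
iterated-separated : ∀ k {p : ℝ → ℝ} {P : Vec ℝ k → ℝ} {Q : Vec ℝ (suc k) → ℝ} {c d} →
  (∀ ts t n → seq (p t) n ℚ.* seq (P ts) n ≡ seq (Q (ts ∷ʳ t)) n) →
  HasIntegral p 0ℝ 1ℝ c → HasIteratedIntegral k P d → HasIteratedIntegral (suc k) Q (c * d)
iterated-separated k {p} {P} {Q} {c} {d} Q≗pP hp hP = (λ t → d * p t + 0ℝ) , inner ,
  hasIntegral-resp {λ t → d * p t + 0ℝ} {0ℝ} {1ℝ} {d * c + 0ℝ} {c * d}
    (λ n → solve 2 (λ c d → d :* c :+ con 0ℚ := c :* d) refl (seq c n) (seq d n))
    (hasIntegral-linear d {p} {λ _ → 0ℝ} {0ℝ} {1ℝ} {c} {0ℝ} hp hasIntegral-0)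
  where
  inner : ∀ t → 0ℝ ≤ t → t ≤ 1ℝ → HasIteratedIntegral k (λ ts → Q (ts ∷ʳ t)) (d * p t + 0ℝ)
  inner t _ _ = iterated-resp k {λ ts → p t * P ts} {λ ts → Q (ts ∷ʳ t)} {p t * d} {d * p t + 0ℝ}
    (λ ts → Q≗pP ts t)
    (λ n → solve 2 (λ p d → p :* d := d :* p :+ con 0ℚ) refl (seq (p t) n) (seq d n))
    (iterated-scale k (p t) {P} {d} hP)

iterated-power-suc : ∀ k i q {r} → (+ 1 ℚ./ suc i) ℚ.* q ≡ r →
  HasIteratedIntegral k (λ ts → power i (Π ts)) (fromℚ q) →
  HasIteratedIntegral (suc k) (λ ts → power i (Π ts)) (fromℚ r)
iterated-power-suc k i q {r} eq h = iterated-resp (suc k) {λ ts → power i (Π ts)} {λ ts → power i (Π ts)}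
  {fromℚ (+ 1 ℚ./ suc i) * fromℚ q} {fromℚ r} (λ _ _ → refl) (λ _ → eq)
  (iterated-separated k {power i} {λ ts → power i (Π ts)} {λ ts → power i (Π ts)} {fromℚ (+ 1 ℚ./ suc i)} {fromℚ q}
    (λ ts t n → trans (cong₂ ℚ._*_ (seq-power i t n) (seq-power i (Π ts) n))
      (trans (sym (^-distrib-* (seq t n) (seq (Π ts) n) i))
        (trans (cong (ℚΣ._^ i) (sym (seq-Π-∷ʳ ts t n))) (sym (seq-power i (Π (ts ∷ʳ t)) n)))))
    (hasIntegral-power i) h)

-- Integral of (t₁⋯tₖ)ⁱ over the unit cube, one factor 1/(i + 1) per variable.
moment : ℕ → ℕ → ℚ
moment i k = (+ 1 ℚ./ suc i) ℚΣ.^ k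

iterated-power : ∀ k i → HasIteratedIntegral k (λ ts → power i (Π ts)) (fromℚ (moment i k))
iterated-power zero    i = ≗⇒≈ {power i 1ℝ} {fromℚ (moment i 0)} λ n → trans (seq-power i 1ℝ n) (^-zeroˡ i)
iterated-power (suc k) i = iterated-power-suc k i (moment i k) {moment i (suc k)} refl (iterated-power k i)

seq-product : ∀ m (f : Fin m → ℝ) n → seq (product f) n ≡ ℚΣ.product (λ i → seq (f i) n)
seq-product zero    f n = refl
seq-product (suc m) f n = cong (seq (f zero) n ℚ.*_) (seq-product m (f ∘ suc) n)

iterated-ℂ : ∀ k j w → HasIteratedIntegral k (λ ts → power j (w - Π ts)) (ℂ j k w)
iterated-ℂ k zero      w = iterated-resp k {λ ts → power 0 (Π ts)} {λ ts → power 0 (w - Π ts)} {fromℚ (moment 0 k)} {1ℝ}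
  (λ _ _ → refl) (λ _ → ^-zeroˡ k) (iterated-power k 0)
iterated-ℂ k j@(suc _) w = iterated-resp k
  {λ ts → sum {suc j} (λ i → c i * power (toℕ i) (Π ts))} {λ ts → power j (w - Π ts)} {sum {suc j} (λ i → c i * d i)} {ℂ j k w}
  integrand value (iterated-sum k (suc j) c {λ i ts → power (toℕ i) (Π ts)} {d} (λ i → iterated-power k (toℕ i)))
  where
  c d : Fin (suc j) → ℝ
  -- Coefficient of (t₁⋯tₖ)ⁱ in the binomial expansion of (w - t₁⋯tₖ)ʲ.
  c i = fromℚ ([-1]^ toℕ i ℚ.* fromℕ (j C toℕ i)) * power (j ∸ toℕ i) w
  d i = fromℚ (moment (toℕ i) k)
  integrand : ∀ ts n → seq (sum {suc j} (λ i → c i * power (toℕ i) (Π ts))) n ≡ seq (power j (w - Π ts)) n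
  integrand ts n = begin
    seq (sum {suc j} (λ i → c i * power (toℕ i) (Π ts))) n
      ≡⟨ seq-sum (suc j) (λ i → c i * power (toℕ i) (Π ts)) n ⟩
    ℚΣ.sum (λ i → seq (c i) n ℚ.* seq (power (toℕ i) (Π ts)) n)
      ≡⟨ sum-cong-≗ (λ (i : Fin (suc j)) → term (toℕ i)) ⟩
    ℚΣ.sum {suc j} (λ i → fromℕ (j C toℕ i) ℚ.* ((ℚ.- p) ℚΣ.^ toℕ i ℚ.* seq w n ℚΣ.^ (j ∸ toℕ i)))
      ≡⟨ sym (binomialTheorem j (ℚ.- p) (seq w n)) ⟩
    (ℚ.- p ℚ.+ seq w n) ℚΣ.^ j
      ≡⟨ cong (ℚΣ._^ j) (ℚₚ.+-comm (ℚ.- p) (seq w n)) ⟩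
    (seq w n ℚ.- p) ℚΣ.^ j
      ≡⟨ sym (seq-power j (w - Π ts) n) ⟩
    seq (power j (w - Π ts)) n ∎
    where
    open ≡-Reasoning
    p = seq (Π ts) n
    term : ∀ i → [-1]^ i ℚ.* fromℕ (j C i) ℚ.* seq (power (j ∸ i) w) n ℚ.* seq (power i (Π ts)) n ≡
      fromℕ (j C i) ℚ.* ((ℚ.- p) ℚΣ.^ i ℚ.* seq w n ℚΣ.^ (j ∸ i))
    term i = trans
      (cong₂ (λ q r → [-1]^ i ℚ.* fromℕ (j C i) ℚ.* q ℚ.* r) (seq-power (j ∸ i) w n) (seq-power i (Π ts) n))
      (trans
        (solve 4 (λ s c q r → s :* c :* q :* r := c :* (s :* r :* q)) refl
          ([-1]^ i) (fromℕ (j C i)) (seq w n ℚΣ.^ (j ∸ i)) (p ℚΣ.^ i))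
        (cong (λ r → fromℕ (j C i) ℚ.* (r ℚ.* seq w n ℚΣ.^ (j ∸ i))) (sym (neg-^ p i))))
  value : ∀ n → seq (sum {suc j} (λ i → c i * d i)) n ≡ seq (ℂ j k w) n
  value n = trans (seq-sum (suc j) (λ i → c i * d i) n) (trans
    (sum-cong-≗ (λ (i : Fin (suc j)) →
      solve 4 (λ s c p q → s :* c :* p :* q := s :* q :* c :* p) refl
        ([-1]^ toℕ i) (fromℕ (j C toℕ i)) (seq (power (j ∸ toℕ i) w) n) (moment (toℕ i) k)))
    (sym (seq-sum (suc j) (λ i → fromℚ ([-1]^ toℕ i ℚ.* (+ 1 ℚ./ suc (toℕ i)) ℚΣ.^ k ℚ.* fromℕ (j C toℕ i)) * w ^ (j ∸ toℕ i)) n)))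

-- A constant is c times the zeroth power of t₁⋯tₖ, and 1ᵏ = 1.
iterated-const : ∀ k c → HasIteratedIntegral k (λ _ → c) c
iterated-const k c = iterated-resp k {λ ts → c * power 0 (Π ts)} {λ _ → c} {c * fromℚ (moment 0 k)} {c}
  (λ _ n → ℚₚ.*-identityʳ (seq c n))
  (λ n → trans (cong (seq c n ℚ.*_) (^-zeroˡ k)) (ℚₚ.*-identityʳ (seq c n)))
  (iterated-scale k c {λ ts → power 0 (Π ts)} {fromℚ (moment 0 k)} (iterated-power k 0))

iterated-affine : ∀ k a b {f : Vec ℝ k → ℝ} {I} → HasIteratedIntegral k f I → HasIteratedIntegral k (λ ts → a + b * f ts) (a + b * I)
iterated-affine k a b {f} {I} h = iterated-resp k {λ ts → b * f ts + a} {λ ts → a + b * f ts} {b * I + a} {a + b * I}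
  (λ ts n → ℚₚ.+-comm (seq b n ℚ.* seq (f ts) n) (seq a n)) (λ n → ℚₚ.+-comm (seq b n ℚ.* seq I n) (seq a n))
  (iterated-linear k b {f} {λ _ → a} {I} {a} h (iterated-const k a))

-- Integration of the double sum and conclusion

seq-sumFrom1 : ∀ n (f : (i : ℕ) → .{{ℕ.NonZero i}} → ℝ) (g : ℕ → ℚ) r → (∀ i → seq (f (suc i)) r ≡ g i) →
  seq (sumFrom1 n f) r ≡ ℚΣ.sum {n} (λ i → g (toℕ i))
seq-sumFrom1 n f g r f≡g = trans (seq-sum n (λ i → f (suc (toℕ i))) r) (sum-cong-≗ (λ (i : Fin n) → f≡g (toℕ i)))

seq-∑[1/m] : ∀ n (h : ℕ → ℕ) (g : ℕ → ℝ) r →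
  seq (∑[1≤ m ≤ n ] fromℚ ((+ 1 ℚ./ m) ℚ.* fromℕ (h (m ∸ 1))) * g m) r ≡
  ℚΣ.sum {n} (λ m → (+ 1 ℚ./ suc (toℕ m)) ℚ.* fromℕ (h (toℕ m)) ℚ.* seq (g (suc (toℕ m))) r)
seq-∑[1/m] n h g r = seq-sumFrom1 n (λ m {{m≢0}} → fromℚ ((+ 1 ℚ./ m) {{m≢0}} ℚ.* fromℕ (h (m ∸ 1))) * g m)
  (λ m → (+ 1 ℚ./ suc m) ℚ.* fromℕ (h m) ℚ.* seq (g (suc m)) r) r (λ m → refl)

module _ (coeff : ℕ → ℕ → ℚ) where

  private
    innerSum : (ℕ → ℝ) → ℕ → ℝ
    innerSum f m = ∑[1≤ j ≤ m ] fromℚ (coeff m j) * f j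

    outerSum : (ℕ → ℝ) → ℕ → ℝ
    outerSum f n = ∑[1≤ m ≤ n ] fromℚ ((+ 1 ℚ./ m) ℚ.* fromℕ (stirling₁ (n ∸ 1) (m ∸ 1))) *
      (∑[1≤ j ≤ m ] fromℚ (coeff m j) * f j)

    weight : ℕ → ℕ → ℚ
    weight n m = (+ 1 ℚ./ suc m) ℚ.* fromℕ (stirling₁ (n ∸ 1) m)

    seq-outerSum : ∀ f n r → seq (outerSum f n) r ≡
      ℚΣ.sum {n} (λ m → weight n (toℕ m) ℚ.* seq (innerSum f (suc (toℕ m))) r)
    seq-outerSum f n = seq-∑[1/m] n (stirling₁ (n ∸ 1)) (λ m → ∑[1≤ j ≤ m ] fromℚ (coeff m j) * f j)

  -- Shape common to both kinds, which differ only in `coeff` and in the argument of ℂ_j. With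
  -- powers uʲ for `f` it is n! times the integrand; with the ℂ_j it is the claimed value. It is
  -- affine in `f`, so integration passes from one to the other.
  expansion : (ℕ → ℝ) → ℕ → ℝ
  expansion f n = fromℚ (δ n 1) + fromℚ ([-1]^ n ℚ.* fromℕ n) *
    (∑[1≤ m ≤ n ] fromℚ ((+ 1 ℚ./ m) ℚ.* fromℕ (stirling₁ (n ∸ 1) (m ∸ 1))) *
      (∑[1≤ j ≤ m ] fromℚ (coeff m j) * f j))

  module _ (k : ℕ) (f : ℕ → Vec ℝ k → ℝ) (I : ℕ → ℝ) (h : ∀ j → HasIteratedIntegral k (f j) (I j)) where

    iterated-innerSum : ∀ m → HasIteratedIntegral k (λ ts → innerSum (λ j → f j ts) m) (innerSum I m)
    iterated-innerSum m = iterated-sum k m (λ j → fromℚ (coeff m (suc (toℕ j))))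
      {λ j → f (suc (toℕ j))} {λ j → I (suc (toℕ j))} (λ j → h (suc (toℕ j)))

    iterated-outerSum : ∀ n → HasIteratedIntegral k (λ ts → outerSum (λ j → f j ts) n) (outerSum I n)
    iterated-outerSum n = iterated-resp k
      {λ ts → sum {n} (λ m → fromℚ (weight n (toℕ m)) * innerSum (λ j → f j ts) (suc (toℕ m)))} {λ ts → outerSum (λ j → f j ts) n}
      {sum {n} (λ m → fromℚ (weight n (toℕ m)) * innerSum I (suc (toℕ m)))} {outerSum I n}
      (λ ts → outer≗ (λ j → f j ts)) (outer≗ I)
      (iterated-sum k n (λ m → fromℚ (weight n (toℕ m))) {λ m ts → innerSum (λ j → f j ts) (suc (toℕ m))}
        {λ m → innerSum I (suc (toℕ m))} (λ m → iterated-innerSum (suc (toℕ m))))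
      where
      outer≗ : ∀ g r → seq (sum {n} (λ m → fromℚ (weight n (toℕ m)) * innerSum g (suc (toℕ m)))) r ≡ seq (outerSum g n) r
      outer≗ g r = trans (seq-sum n (λ m → fromℚ (weight n (toℕ m)) * innerSum g (suc (toℕ m))) r) (sym (seq-outerSum g n r))

    iterated-expansion : ∀ n → HasIteratedIntegral k (λ ts → expansion (λ j → f j ts) n) (expansion I n)
    iterated-expansion n = iterated-resp k
      {λ ts → a + b * outerSum (λ j → f j ts) n} {λ ts → expansion (λ j → f j ts) n} {a + b * outerSum I n} {expansion I n}
      (λ _ _ → refl) (λ _ → refl)
      (iterated-affine k a b {λ ts → outerSum (λ j → f j ts) n} {outerSum I n} (iterated-outerSum n))
      where
      a = fromℚ (δ n 1)
      b = fromℚ ([-1]^ n ℚ.* fromℕ n)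

  module _ (s : ℚ) (coeff≡ : ∀ m j → coeff m j ≡ s ℚΣ.^ j ℚ.* (fromℕ (m C j) ℚ.* bernoulli (m ∸ j))) where

    -- The sign sʲ of the coefficient merges with uʲ, so the Bernoulli sums are evaluated at y = s
    -- u. The first kind has s = 1, the second s = -1.
    seq-expansion : ∀ n u r → seq (expansion (λ j → power j u) n) r ≡ fallExpansion n (s ℚ.* seq u r)
    seq-expansion n u r = cong (λ q → δ n 1 ℚ.+ [-1]^ n ℚ.* fromℕ n ℚ.* q)
      (trans (seq-outerSum (λ j → power j u) n r)
        (sum-cong-≗ (λ (m : Fin n) → cong (weight n (toℕ m) ℚ.*_) (seq-innerSum (suc (toℕ m))))))
      where
      term : ∀ m j → coeff m j ℚ.* seq (power j u) r ≡ fromℕ (m C j) ℚ.* bernoulli (m ∸ j) ℚ.* (s ℚ.* seq u r) ℚΣ.^ j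
      term m j = trans (cong₂ ℚ._*_ (coeff≡ m j) (seq-power j u r))
        (trans (solve 3 (λ σ c p → σ :* c :* p := c :* (σ :* p)) refl (s ℚΣ.^ j) (fromℕ (m C j) ℚ.* bernoulli (m ∸ j)) (seq u r ℚΣ.^ j))
          (cong (fromℕ (m C j) ℚ.* bernoulli (m ∸ j) ℚ.*_) (sym (^-distrib-* s (seq u r) j))))
      seq-innerSum : ∀ m → seq (innerSum (λ j → power j u) m) r ≡ bernoulliSum m (s ℚ.* seq u r)
      seq-innerSum m = trans (seq-sum m (λ j → fromℚ (coeff m (suc (toℕ j))) * power (suc (toℕ j)) u) r)
        (sum-cong-≗ (λ (j : Fin m) → term m (suc (toℕ j))))

    seq-binom : ∀ n z u r → 1ℚ ℚ.- s ℚ.* seq u r ≡ seq z r →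
      1/ suc n ! ℚ.* seq (expansion (λ j → power j u) (suc n)) r ≡ seq (binom z (suc n)) r
    seq-binom n z u r 1-su≡z = cong (1/ suc n ! ℚ.*_) (begin
      seq (expansion (λ j → power j u) (suc n)) r     ≡⟨ seq-expansion (suc n) u r ⟩
      fallExpansion (suc n) (s ℚ.* seq u r)           ≡⟨ sym (fall≡fallExpansion n (s ℚ.* seq u r)) ⟩
      fall (1ℚ ℚ.- s ℚ.* seq u r) (suc n)             ≡⟨ cong (λ q → fall q (suc n)) 1-su≡z ⟩
      fall (seq z r) (suc n)                          ≡⟨ sym (seq-product (suc n) (λ i → z - fromℚ (fromℕ (toℕ i))) r) ⟩
      seq (product {suc n} (λ i → z - fromℚ (fromℕ (toℕ i)))) r   ∎)
      where open ≡-Reasoning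

    -- The integral of the binomial coefficient is the claimed value `V` divided by n!, the factor
    -- that the definition of the polynomial multiplies back.
    polyCauchy : ∀ k w n (z : Vec ℝ k → ℝ) → (∀ ts r → 1ℚ ℚ.- s ℚ.* seq (w - Π ts) r ≡ seq (z ts) r) →
      ∃ λ I → HasIteratedIntegral k (λ ts → binom (z ts) (suc n)) I ×
        expansion (λ j → ℂ j k w) (suc n) ≈ fromℚ (fromℕ (suc n !)) * I
    polyCauchy k w n z 1-su≡z = fromℚ (1/ suc n !) * V
      , iterated-resp k {λ ts → fromℚ (1/ suc n !) * expansion (λ j → power j (w - Π ts)) (suc n)} {λ ts → binom (z ts) (suc n)}
          {fromℚ (1/ suc n !) * V} {fromℚ (1/ suc n !) * V}
          (λ ts r → seq-binom n (z ts) (w - Π ts) r (1-su≡z ts r)) (λ _ → refl)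
          (iterated-scale k (fromℚ (1/ suc n !)) {λ ts → expansion (λ j → power j (w - Π ts)) (suc n)} {V}
            (iterated-expansion k (λ j ts → power j (w - Π ts)) (λ j → ℂ j k w) (λ j → iterated-ℂ k j w) (suc n)))
      , ≗⇒≈ {V} {fromℚ (fromℕ (suc n !)) * (fromℚ (1/ suc n !) * V)} (λ r → sym (trans
          (sym (ℚₚ.*-assoc (fromℕ (suc n !)) (1/ suc n !) (seq V r)))
          (trans (cong (ℚ._* seq V r) (n!*1/n! (suc n))) (ℚₚ.*-identityˡ (seq V r)))))
      where
      V = expansion (λ j → ℂ j k w) (suc n)

theorem9 : (n k : ℕ) → 1 ℕ.≤ n → 1 ℕ.≤ k → (x : ℝ) →
    IsPolyCauchy₁ n k x
      (fromℚ (δ n 1) + fromℚ ([-1]^ n ℚ.* fromℕ n) *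
        (∑[1≤ m ≤ n ] fromℚ ((+ 1 ℚ./ m) ℚ.* fromℕ (stirling₁ (n ∸ 1) (m ∸ 1))) *
          (∑[1≤ j ≤ m ] fromℚ (fromℕ (m C j) ℚ.* bernoulli (m ∸ j)) * ℂ j k (x + 1ℝ))))
    ×
    IsPolyCauchy₂ n k x
      (fromℚ (δ n 1) + fromℚ ([-1]^ n ℚ.* fromℕ n) *
        (∑[1≤ m ≤ n ] fromℚ ((+ 1 ℚ./ m) ℚ.* fromℕ (stirling₁ (n ∸ 1) (m ∸ 1))) *
          (∑[1≤ j ≤ m ] fromℚ ([-1]^ j ℚ.* fromℕ (m C j) ℚ.* bernoulli (m ∸ j)) * ℂ j k (x - 1ℝ))))
theorem9 (suc n) k _ _ x =
    -- The shift comes from solving 1 - (w - p) = p - x, which gives w = x + 1.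
    polyCauchy (λ m j → fromℕ (m C j) ℚ.* bernoulli (m ∸ j)) 1ℚ
      (λ m j → sym (trans (cong (ℚ._* (fromℕ (m C j) ℚ.* bernoulli (m ∸ j))) (^-zeroˡ j)) (ℚₚ.*-identityˡ (fromℕ (m C j) ℚ.* bernoulli (m ∸ j)))))
      k (x + 1ℝ) n (λ ts → Π ts - x)
      (λ ts r → solve 2 (λ x p → con 1ℚ :- con 1ℚ :* (x :+ con 1ℚ :- p) := p :- x) refl (seq x r) (seq (Π ts) r))
  -- Here 1 + (w - p) = x - p gives w = x - 1.
  , polyCauchy (λ m j → [-1]^ j ℚ.* fromℕ (m C j) ℚ.* bernoulli (m ∸ j)) (ℚ.- 1ℚ)
      (λ m j → ℚₚ.*-assoc ([-1]^ j) (fromℕ (m C j)) (bernoulli (m ∸ j)))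
      k (x - 1ℝ) n (λ ts → x - Π ts)
      (λ ts r → solve 2 (λ x p → con 1ℚ :- :- con 1ℚ :* (x :- con 1ℚ :- p) := x :- p) refl (seq x r) (seq (Π ts) r))
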